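{- There is an ensemble of encodings $\{D_N\}$, indexed by the binary representations $\langle N\rangle$ of natural numbers $N \geq 1$, such that for every $N$, $D_N : [I_N] \rightarrow \mathrm{QR}(N)$ is an encoding of $\mathrm{QR}(N)$ with $I_N = |\mathrm{QR}(N)|$ (so $D_N$ is an indexing of $\mathrm{QR}(N)$), and the ensemble $\{D_N\}$ is decodable by polynomial size circuits. That is, there is a polynomial $q$ such that for every $N$ there is a Boolean circuit $C_N$ of size at most $q(|\langle N\rangle|)$ that, on input (the binary representation of) any $i \in [I_N]$, outputs (the binary representation of) $D_N(i)$.
   Context: For a natural number $M$, $[M] = \{1,2,\dots,M\}$ (so $[0]=\emptyset$). For a natural number $N$, $\mathbb{Z}_N^* = \{1 \leq x \leq N-1 \mid \gcd(x,N)=1\}$ and $\mathrm{QR}(N) = \{z \in \mathbb{Z}_N^* \mid \exists x \in \mathbb{Z}_N^* \text{ such that } z \equiv x^2 \pmod N\}$ is the set of quadratic residues modulo $N$. An encoding of a finite set $S$ is a function $D : [I] \rightarrow S$ such that for every $s \in S$ there exists $i \in [I]$ with $D(i) = s$ (i.e. a surjection). An indexing is an encoding with $I = |S|$ (hence a bijection). An ensemble of encodings $\{D_x\}$ is an infinite sequence of encodings $D_x$ with domain $[N_x]$, each uniquely identified by a string $x$. The ensemble is decodable by polynomial size circuits if for each $x$ there is a circuit of size $\mathrm{poly}(|x|)$ that computes $D_x(i)$ for every $i \in [N_x]$, where $|x|$ is the length of the string $x$; a different circuit is allowed for each $x$, and the polynomial bound is the same for all $x$. -}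

module Defs where

open import Data.Bool.Base as Bool using (Bool; _∧_; _∨_)
open import Data.Digit using (toDigits; fromDigits)
open import Data.Fin.Base using (Fin)
open import Data.Fin.Properties using (2↔Bool)
open import Data.List.Base as List using (List; length)
open import Data.List.Properties using (map-injective)
open import Data.Nat.Base using (ℕ; suc; _+_; _*_; _≤_; _<_; ∣_-_∣)
open import Data.Nat.Divisibility using (_∣_)
open import Data.Nat.DivMod using (_/_; _mod_)
open import Data.Nat.GCD using (gcd)
open import Data.Nat.Properties using (suc-injective)
open import Data.Product.Base using (∃; ∃-syntax; Σ-syntax; _×_; proj₁; proj₂)
open import Data.Vec.Base as Vec using (Vec; []; _∷_; lookup; toList)
open import Function.Base using (_∘_)
open import Function.Bundles using (Injection; Surjection; Bijection; module Inverse; _↣_; mk↣)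
open import Function.Consequences.Propositional using (inverseʳ⇒injective)
open import Level using (0ℓ)
open import Relation.Binary.Bundles using (Setoid)
import Relation.Binary.Construct.On as On
open import Relation.Binary.PropositionalEquality using (_≡_; setoid; cong; sym; trans)
open import Relation.Unary using (Pred)

------------------------------------------------------------------------
-- Quadratic residues

_≡_[mod_] : ℕ → ℕ → ℕ → Set
a ≡ b [mod N ] = N ∣ ∣ a - b ∣

ℤ*[_] : ℕ → Pred ℕ 0ℓ
ℤ*[ N ] x = 1 ≤ x × x < N × gcd x N ≡ 1

QR : ℕ → Pred ℕ 0ℓ
QR N z = ℤ*[ N ] z × (∃[ x ] ℤ*[ N ] x × z ≡ x * x [mod N ])

------------------------------------------------------------------------
-- Encodings

-- Elements are compared as numbers: membership proofs are ignored.
Elements : Pred ℕ 0ℓ → Setoid 0ℓ 0ℓ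
Elements S = On.setoid {B = ∃ S} (setoid ℕ) proj₁

[_] : ℕ → Pred ℕ 0ℓ
[ M ] i = 1 ≤ i × i ≤ M

-- S is finite and has exactly n elements.
HasCardinality : Pred ℕ 0ℓ → ℕ → Set
HasCardinality S n = Bijection (Elements [ n ]) (Elements S)

record Encoding (S : Pred ℕ 0ℓ) : Set where
  field
    size   : ℕ
    decode : Surjection (Elements [ size ]) (Elements S)

  value : ∃ [ size ] → ℕ
  value i = proj₁ (Surjection.to decode i)

IsIndexing : ∀ {S} → Encoding S → Set
IsIndexing {S} E = HasCardinality S (Encoding.size E)

Ensemble : (ℕ → Pred ℕ 0ℓ) → Set
Ensemble S = ∀ n → Encoding (S n)

------------------------------------------------------------------------
-- Binary representations, least significant bit first

open Inverse 2↔Bool using () renaming (to to toBool; from to fromBool)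

⟨_⟩ : ℕ → List Bool
⟨ n ⟩ = List.map toBool (proj₁ (toDigits 2 n))

-- The w low-order bits of n; for n < 2 ^ w this is the binary representation
-- of n padded with zeros to width w.
toBits : ∀ w → ℕ → Vec Bool w
toBits 0       n = []
toBits (suc w) n = toBool (n mod 2) ∷ toBits w (n / 2)

fromBits : ∀ {w} → Vec Bool w → ℕ
fromBits bs = fromDigits (List.map fromBool (toList bs))

⟨⟩-injective : ∀ {m n} → ⟨ m ⟩ ≡ ⟨ n ⟩ → m ≡ n
⟨⟩-injective {m} {n} eq =
  trans (sym (proj₂ (toDigits 2 m)))
    (trans (cong fromDigits (map-injective toBool-injective eq)) (proj₂ (toDigits 2 n)))
  where
  toBool-injective : ∀ {a b} → toBool a ≡ toBool b → a ≡ b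
  toBool-injective = inverseʳ⇒injective toBool (Inverse.inverseʳ 2↔Bool)

-- The numbers N ≥ 1 are enumerated as suc n.
⟨suc⟩ : ℕ ↣ List Bool
⟨suc⟩ = mk↣ {to = λ n → ⟨ suc n ⟩} (suc-injective ∘ ⟨⟩-injective)

------------------------------------------------------------------------
-- Boolean circuits

data Gate (w : ℕ) : Set where
  CONST  : Bool → Gate w
  NOT    : Fin w → Gate w
  AND OR : Fin w → Fin w → Gate w

-- Gates n w: a topologically ordered acyclic network with n inputs and w wires
-- in all. Each gate reads earlier wires and adds one wire, which becomes wire 0.
data Gates (n : ℕ) : ℕ → Set where
  []  : Gates n n
  _▸_ : ∀ {w} → Gates n w → Gate w → Gates n (suc w)

record Circuit (n m : ℕ) : Set where
  constructor circuit
  field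
    {wires} : ℕ
    gates   : Gates n wires
    outputs : Vec (Fin wires) m

evalGate : ∀ {w} → Gate w → Vec Bool w → Bool
evalGate (CONST b) v = b
evalGate (NOT i)   v = Bool.not (lookup v i)
evalGate (AND i j) v = lookup v i ∧ lookup v j
evalGate (OR i j)  v = lookup v i ∨ lookup v j

evalGates : ∀ {n w} → Gates n w → Vec Bool n → Vec Bool w
evalGates []       x = x
evalGates (gs ▸ g) x = let v = evalGates gs x in evalGate g v ∷ v

eval : ∀ {n m} → Circuit n m → Vec Bool n → Vec Bool m
eval C x = Vec.map (lookup (evalGates gates x)) outputs
  where open Circuit C

-- Inputs, gates and outputs are all counted.
circuitSize : ∀ {n m} → Circuit n m → ℕ
circuitSize {m = m} C = Circuit.wires C + m

------------------------------------------------------------------------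
-- Decodability

-- Coefficients in order of increasing degree. Natural coefficients suffice,
-- since polynomials are used only as upper bounds.
Polynomial : Set
Polynomial = List ℕ

evalPoly : Polynomial → ℕ → ℕ
evalPoly q x = List.foldr (λ a r → a + x * r) 0 q

-- Indices i ≤ size are fed to C zero-padded to the width of ⟨ size ⟩; the
-- output may likewise carry leading zeros.
Computes : ∀ {S m} (E : Encoding S) → Circuit (length ⟨ Encoding.size E ⟩) m → Set
Computes E C = ∀ i → fromBits (eval C (toBits _ (proj₁ i))) ≡ Encoding.value E i

-- The n-th encoding of the sequence is identified by the string name n.
PolySizeDecodable : ∀ {S} → (name : ℕ ↣ List Bool) → Ensemble S → Set
PolySizeDecodable name D =
  Σ[ q ∈ Polynomial ] ∀ n →
    ∃[ m ] Σ[ C ∈ Circuit (length ⟨ Encoding.size (D n) ⟩) m ]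
      circuitSize C ≤ evalPoly q (length (Injection.to name n)) × Computes (D n) C

{-# OPTIONS --safe #-}

-- QR(N) is exhausted by a chain of subgroups 1 = H₀ < H₁ < … < H_k, where H_{j+1} is obtained from H_j by
-- adjoining a residue g ∉ H_j. If r is the least positive exponent with g^r ∈ H_j, every element of H_{j+1} is
-- uniquely g^q h with q < r and h ∈ H_j, so the mixed radix digits of an index select an element of QR(N).
-- Each step at least doubles the subgroup, hence k ≤ log N. Writing q in binary, decoding is a list of at most
-- log² N steps "if i ≥ T then subtract T from i and multiply the accumulator by h mod N" with constants
-- T = |H_j| 2^t and h = g^(2^t), each of which takes polynomially many gates.
module Submission where

open import Data.Bool.Base using (Bool; true; false; not; _∧_; _∨_; _xor_; if_then_else_)
open import Data.Digit using (Expansion; fromDigits; toDigits)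
open import Data.Fin.Base using (Fin; zero; suc; toℕ; fromℕ<)
open import Data.Fin.Properties using (2↔Bool; toℕ-fromℕ<; toℕ<n; toℕ-injective; pigeonhole; injective⇒≤)
open import Data.List.Base as List using (List; []; _∷_; _++_; length)
open import Data.List.Properties using (length-map; length-++)
open import Data.List.Relation.Unary.All as All using (All; []; _∷_)
open import Data.List.Relation.Unary.All.Properties using (++⁺)
open import Data.Nat.Base
open import Data.Nat.Coprimality as Coprime using (Coprime; coprime-divisor; gcd≡1⇒coprime; coprime⇒gcd≡1)
open import Data.Nat.Divisibility
open import Data.Nat.DivMod
open import Data.Nat.GCD using (gcd)
open import Data.Nat.Induction using (Acc; acc; <′-Rec; <′-wellFounded′)
open import Data.Nat.Properties
open import Data.Nat.Solver using (module +-*-Solver)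
open import Data.Product.Base using (∃; Σ-syntax; ∃-syntax; _×_; _,_; proj₁; proj₂)
open import Data.Sum.Base using (_⊎_; inj₁; inj₂)
open import Data.Unit.Base using (⊤; tt)
open import Data.Vec.Base as Vec using (Vec; []; _∷_; lookup)
open import Data.Vec.Properties using (map-lookup-allFin)
open import Function.Base using (id; _∘_; case_of_)
open import Function.Bundles using (module Inverse; module Surjection)
open import Induction.WellFounded using (module Some)
open import Level using (0ℓ)
open import Relation.Binary.PropositionalEquality
open import Relation.Nullary.Decidable using (Dec; yes; no; map′; _×-dec_; ¬?; decidable-stable)
open import Relation.Nullary.Negation using (¬_; contradiction)
open import Relation.Unary using (Pred; Decidable)
open import Defs

-- Length of binary representations

-- A circuit may depend on N in any way, so the adjoined residues, their relative orders and all
-- needed powers are hard-wired constants. Their existence is shown by exhaustive search, and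
-- neither the factorisation of N nor the structure theorem for abelian groups enters. QR(N) need
-- not be cyclic, hence residues are adjoined one at a time. The relative orders r need not be
-- powers of two, so the bits of an index are not themselves the exponents; greedy comparison with
-- the thresholds extracts the digits without a division circuit. Every multiplication has a
-- constant factor and becomes a sequence of modular additions of constants. Inverses never have to
-- be constructed: cancellation makes every element of finite order, and a power then serves as its
-- inverse. A separate obstacle is that the input width is the binary length of |QR(N)|, whereas the
-- size has to be bounded in the length of N. This requires binary length to be monotone, hence the
-- analysis of `toDigits`.

Digits : ℕ → Set
Digits n = ∃ λ (ds : Expansion 2) → fromDigits ds ≡ n

-- The exponent is `suc L` because zero is written with one digit, so a bound by L would fail for n
-- = 0 and L = 0.
record Short (n : ℕ) (ds : Expansion 2) : Set where
  constructor short
  field length≤ : ∀ L → n < 2 ^ suc L → length ds ≤ suc L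

-- Induction along the recursion: a property preserved by one unfolding holds of every value the
-- recursor returns, whatever the accessibility proof.
<′-rec-elim : ∀ {P : ℕ → Set} (f : ∀ n → <′-Rec P n → P n) (Q : ∀ n → P n → Set) →
  (∀ n (rec : <′-Rec P n) → (∀ {m} (m<n : m <′ n) → Q m (rec m<n)) → Q n (f n rec)) →
  ∀ {n} (q : Acc _<′_ n) {m} (m<n : m <′ n) → Q m (Some.wfRecBuilder P f n q m<n)
<′-rec-elim f Q step (acc rs) {m} m<n = step m _ (<′-rec-elim f Q step (rs m<n))

short-[_] : ∀ {n} (r : Fin 2) → Short n (r ∷ [])
short-[ r ] = short λ L _ → s≤s z≤n

short-∷ : ∀ (r : Fin 2) {x ds} → Short (suc x) ds → Short (toℕ r + suc x * 2) (r ∷ ds)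
short-∷ r {x} sh = short λ where
  zero    n<2 → contradiction n<2 (≤⇒≯ (m≤n⇒m≤o+n (toℕ r) (m≤m+n 2 _)))
  (suc L) n<  → s≤s (Short.length≤ sh L (*-cancelʳ-< 2 (suc x) (2 ^ suc L)
    (≤-<-trans (m≤n+m _ (toℕ r)) (<-≤-trans n< (≤-reflexive (*-comm 2 (2 ^ suc L)))))))

-- toDigits recurses through a function local to its definition, which cannot be named from here. The two
-- underscores in digitStep are solved with that function (for the two values of the second digit) by the uses
-- of <′-rec-elim in toDigits-short; abstracting <′-wellFounded′ n is what makes this unification succeed.
mutual
  digitStep : Fin 2 → Fin 2 → ℕ → ∀ n → <′-Rec Digits n → Digits n
  digitStep zero       r y = _
  digitStep (suc zero) r y = _

  toDigits-short : ∀ n → Short n (proj₁ (toDigits 2 n))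
  toDigits-short n with (λ {m} → <′-wellFounded′ n {m}) | n divMod 2
  ... | w | result zero r eq = short-[ r ]
  ... | w | result (suc x) r refl with suc x divMod 2
  ...   | result zero    s eq = short-∷ r {x} short-[ s ]
  ...   | result (suc y) zero       refl =
          short-∷ r (short-∷ zero {y}
            (<′-rec-elim (digitStep zero r y) (λ n d → Short n (proj₁ d)) (digitStep-short zero r y) (w _) _))
  ...   | result (suc y) (suc zero) refl =
          short-∷ r (short-∷ (suc zero) {y}
            (<′-rec-elim (digitStep (suc zero) r y) (λ n d → Short n (proj₁ d)) (digitStep-short (suc zero) r y) (w _) _))

  digitStep-short : ∀ s r y n (rec : <′-Rec Digits n) →
    (∀ {m} (m<n : m <′ n) → Short m (proj₁ (rec m<n))) → Short n (proj₁ (digitStep s r y n rec))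
  digitStep-short zero       r y n rec ih with n divMod 2
  ... | result zero    t eq   = short-[ t ]
  ... | result (suc x) t refl = short-∷ t {x} (ih _)
  digitStep-short (suc zero) r y n rec ih with n divMod 2
  ... | result zero    t eq   = short-[ t ]
  ... | result (suc x) t refl = short-∷ t {x} (ih _)

-- Circuits

data Ty : Set where
  𝟙 𝔹 : Ty
  _⊗_ : Ty → Ty → Ty

infixr 6 _⊗_

-- At `Fin w` a type describes a bundle of wires, at `Bool` the values they carry; mapping the
-- lookup of an evaluation passes from one to the other.
⟦_⟧ : Ty → Set → Set
⟦ 𝟙 ⟧     A = ⊤
⟦ 𝔹 ⟧     A = A
⟦ u ⊗ v ⟧ A = ⟦ u ⟧ A × ⟦ v ⟧ A

Val : Ty → Set
Val u = ⟦ u ⟧ Bool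

bits : Ty → ℕ
bits 𝟙       = 0
bits 𝔹       = 1
bits (u ⊗ v) = bits u + bits v

mapᵗ : ∀ u {A B : Set} → (A → B) → ⟦ u ⟧ A → ⟦ u ⟧ B
mapᵗ 𝟙       φ _       = tt
mapᵗ 𝔹       φ a       = φ a
mapᵗ (u ⊗ v) φ (x , y) = mapᵗ u φ x , mapᵗ v φ y

mapᵗ-∘ : ∀ u {A B C : Set} {φ : B → C} {ψ : A → B} {χ : A → C} →
  (∀ a → φ (ψ a) ≡ χ a) → ∀ x → mapᵗ u φ (mapᵗ u ψ x) ≡ mapᵗ u χ x
mapᵗ-∘ 𝟙       eq _       = refl
mapᵗ-∘ 𝔹       eq a       = eq a
mapᵗ-∘ (u ⊗ v) eq (x , y) = cong₂ _,_ (mapᵗ-∘ u eq x) (mapᵗ-∘ v eq y)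

read : ∀ u {n w} → Gates n w → ⟦ u ⟧ (Fin w) → Vec Bool n → Val u
read u Γ ι x = mapᵗ u (lookup (evalGates Γ x)) ι

-- A new gate takes wire 0 and shifts the older ones, so `weaken` records where each old wire went.
record Extension {n w} (Γ : Gates n w) (s : ℕ) : Set where
  field
    {wires} : ℕ
    gates   : Gates n wires
    weaken  : Fin w → Fin wires
    sound   : ∀ x i → lookup (evalGates gates x) (weaken i) ≡ lookup (evalGates Γ x) i
    wires≤  : wires ≤ w + s

open Extension

-- f is computed by adding at most s gates to any network carrying its arguments.
record Realised (u v : Ty) (f : Val u → Val v) (s : ℕ) : Set where
  constructor realised
  field
    build : ∀ {n w} (Γ : Gates n w) (ι : ⟦ u ⟧ (Fin w)) →
      Σ[ E ∈ Extension Γ s ] Σ[ o ∈ ⟦ v ⟧ (Fin (wires E)) ]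
        (∀ x → read v (gates E) o x ≡ f (read u Γ ι x))

open Realised

private variable
  u v v₁ v₂ w : Ty
  s t : ℕ

-- Permuting, copying or dropping wires needs no gates. The hypothesis is naturality of `ρ`, which
-- makes its action on wires agree with its action on values.
rewire : ∀ {u v} (ρ : ∀ {A} → ⟦ u ⟧ A → ⟦ v ⟧ A) →
  (∀ {A B : Set} (φ : A → B) x → mapᵗ v φ (ρ x) ≡ ρ (mapᵗ u φ x)) → Realised u v ρ 0
rewire ρ natural .build Γ ι = record
  { gates = Γ ; weaken = id ; sound = λ _ _ → refl ; wires≤ = ≤-reflexive (sym (+-identityʳ _)) }
  , ρ ι , λ x → natural _ ι

here : Realised u u id 0
here {u} = rewire {u} id (λ _ _ → refl)

fst : Realised (u ⊗ v) u proj₁ 0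
fst {u} {v} = rewire {u ⊗ v} {u} proj₁ (λ _ _ → refl)

snd : Realised (u ⊗ v) v proj₂ 0
snd {u} {v} = rewire {u ⊗ v} {v} proj₂ (λ _ _ → refl)

infixl 5 _▹_

_▹_ : ∀ {f : Val u → Val v} {g : Val v → Val w} →
  Realised u v f s → Realised v w g t → Realised u w (λ x → g (f x)) (s + t)
_▹_ {s = s} {t = t} {g = g} F G .build {w = k} Γ ι with F .build Γ ι
... | E₁ , o₁ , ok₁ with G .build (gates E₁) o₁
... | E₂ , o₂ , ok₂ = record
  { gates  = gates E₂
  ; weaken = weaken E₂ ∘ weaken E₁
  ; sound  = λ x i → trans (sound E₂ x _) (sound E₁ x i)
  ; wires≤ = ≤-trans (wires≤ E₂) (≤-trans (+-monoˡ-≤ t (wires≤ E₁)) (≤-reflexive (+-assoc k s t)))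
  } , o₂ , λ x → trans (ok₂ x) (cong g (ok₁ x))

fork : ∀ {f : Val u → Val v₁} {g : Val u → Val v₂} →
  Realised u v₁ f s → Realised u v₂ g t → Realised u (v₁ ⊗ v₂) (λ x → f x , g x) (s + t)
fork {u = u} {v₁ = v₁} {s = s} {t = t} {g = g} F G .build {w = k} Γ ι with F .build Γ ι
... | E₁ , o₁ , ok₁ with G .build (gates E₁) (mapᵗ u (weaken E₁) ι)
... | E₂ , o₂ , ok₂ = record
  { gates  = gates E₂
  ; weaken = weaken E₂ ∘ weaken E₁
  ; sound  = λ x i → trans (sound E₂ x _) (sound E₁ x i)
  ; wires≤ = ≤-trans (wires≤ E₂) (≤-trans (+-monoˡ-≤ t (wires≤ E₁)) (≤-reflexive (+-assoc k s t)))
  } , (mapᵗ v₁ (weaken E₂) o₁ , o₂) , λ x → cong₂ _,_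
    (trans (mapᵗ-∘ v₁ (sound E₂ x) o₁) (ok₁ x))
    (trans (ok₂ x) (cong g (mapᵗ-∘ u (sound E₁ x) ι)))

respects : ∀ {f g : Val u → Val v} → (∀ x → f x ≡ g x) → Realised u v f s → Realised u v g s
respects f≗g F .build Γ ι with F .build Γ ι
... | E , o , ok = E , o , λ x → trans (ok x) (f≗g _)

relax : ∀ {f : Val u → Val v} → s ≤ t → Realised u v f s → Realised u v f t
relax s≤t F .build {w = k} Γ ι with F .build Γ ι
... | E , rest = record
  { gates = gates E ; weaken = weaken E ; sound = sound E
  ; wires≤ = ≤-trans (wires≤ E) (+-monoʳ-≤ k s≤t) } , rest

gate : ∀ {f : Val u → Bool} (g : ∀ {w} → ⟦ u ⟧ (Fin w) → Gate w) →
  (∀ {w} (ν : Vec Bool w) ι → evalGate (g ι) ν ≡ f (mapᵗ u (lookup ν) ι)) → Realised u 𝔹 f 1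
gate g ok .build {w = k} Γ ι = record
  { gates = Γ ▸ g ι ; weaken = suc ; sound = λ _ _ → refl ; wires≤ = ≤-reflexive (+-comm 1 k) }
  , zero , λ x → ok _ ι

constant : ∀ v (a : Val v) → Realised u v (λ _ → a) (bits v)
constant 𝟙       a       = rewire (λ _ → tt) (λ _ _ → refl)
constant 𝔹       b       = gate (λ _ → CONST b) (λ _ _ → refl)
constant (v ⊗ w) (a , b) = fork (constant v a) (constant w b)

-- One multiplexer per bit, (b ∧ x) ∨ (¬b ∧ y), hence four gates each.
select : ∀ v → Realised (𝔹 ⊗ v ⊗ v) v (λ (b , x , y) → if b then x else y) (bits v * 4)
select 𝟙 = rewire (λ _ → tt) (λ _ _ → refl)
select 𝔹 = respects (λ where (true , true , _) → refl
                             (true , false , _) → refl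
                             (false , _ , _) → refl)
  (fork (fork fst (snd ▹ fst) ▹ and) (fork (fst ▹ negation) (snd ▹ snd) ▹ and) ▹ or)
  where
  negation : Realised 𝔹 𝔹 not 1
  negation = gate (λ i → NOT i) (λ _ _ → refl)

  and : Realised (𝔹 ⊗ 𝔹) 𝔹 (λ (a , b) → a ∧ b) 1
  and = gate (λ (i , j) → AND i j) (λ _ _ → refl)

  or : Realised (𝔹 ⊗ 𝔹) 𝔹 (λ (a , b) → a ∨ b) 1
  or = gate (λ (i , j) → OR i j) (λ _ _ → refl)
select (v ⊗ w) = relax (≤-reflexive (sym (*-distribʳ-+ 4 (bits v) (bits w))))
  (respects (λ where (true , _) → refl
                     (false , _) → refl)
  (fork (rewire (λ (b , (x , _) , (x′ , _)) → b , x , x′) (λ _ _ → refl) ▹ select v)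
        (rewire (λ (b , (_ , y) , (_ , y′)) → b , y , y′) (λ _ _ → refl) ▹ select w)))

branch : ∀ {r} {f : Val u → Bool} {g h : Val u → Val v} →
  Realised u 𝔹 f r → Realised u v g s → Realised u v h t →
  Realised u v (λ x → if f x then g x else h x) (r + (s + t) + bits v * 4)
branch {v = v} F G H = fork F (fork G H) ▹ select v

-- Three multiplexers of four gates choose among four constant gates holding the truth table: 4 + 3
-- * 4 = 16.
binary : ∀ (f : Bool → Bool → Bool) → Realised (𝔹 ⊗ 𝔹) 𝔹 (λ (a , b) → f a b) 16
binary f = respects (λ where (true , true) → refl
                             (true , false) → refl
                             (false , true) → refl
                             (false , false) → refl)
  (branch fst (branch snd (constant 𝔹 (f true true)) (constant 𝔹 (f true false)))
              (branch snd (constant 𝔹 (f false true)) (constant 𝔹 (f false false))))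

-- Words, least significant bit first

Word : ℕ → Ty
Word 0       = 𝟙
Word (suc n) = 𝔹 ⊗ Word n

bit : Bool → ℕ
bit true  = 1
bit false = 0

# : ∀ n → Val (Word n) → ℕ
# zero    _       = 0
# (suc n) (b , x) = bit b + 2 * # n x

bits-Word : ∀ n → bits (Word n) ≡ n
bits-Word zero    = refl
bits-Word (suc n) = cong suc (bits-Word n)

bit≤1 : ∀ b → bit b ≤ 1
bit≤1 true  = ≤-refl
bit≤1 false = z≤n

#-< : ∀ n x → # n x < 2 ^ n
#-< zero    x       = ≤-refl
#-< (suc n) (b , x) = begin-strict
  bit b + 2 * # n x ≤⟨ +-monoˡ-≤ _ (bit≤1 b) ⟩
  1 + 2 * # n x     <⟨ ≤-refl ⟩
  2 + 2 * # n x     ≡⟨ *-suc 2 (# n x) ⟨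
  2 * suc (# n x)   ≤⟨ *-monoʳ-≤ 2 (#-< n x) ⟩
  2 * 2 ^ n         ∎
  where open ≤-Reasoning

complement : ∀ n → Val (Word n) → Val (Word n)
complement n = mapᵗ (Word n) not

#-complement : ∀ n x → # n (complement n x) + # n x + 1 ≡ 2 ^ n
#-complement zero    x       = refl
#-complement (suc n) (b , x) = begin
  bit (not b) + 2 * x̄ + (bit b + 2 * ẋ) + 1   ≡⟨ solve 4 (λ nb b x̄ x → nb :+ con 2 :* x̄ :+ (b :+ con 2 :* x) :+ con 1 := (nb :+ b) :+ (con 1 :+ con 2 :* (x̄ :+ x))) refl (bit (not b)) (bit b) x̄ ẋ ⟩
  (bit (not b) + bit b) + (1 + 2 * (x̄ + ẋ))   ≡⟨ cong (_+ (1 + 2 * (x̄ + ẋ))) (one b) ⟩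
  1 + (1 + 2 * (x̄ + ẋ))                       ≡⟨ solve 1 (λ y → con 1 :+ (con 1 :+ con 2 :* y) := con 2 :* (y :+ con 1)) refl (x̄ + ẋ) ⟩
  2 * (x̄ + ẋ + 1)                             ≡⟨ cong (2 *_) (#-complement n x) ⟩
  2 * 2 ^ n                                   ∎
  where
  open ≡-Reasoning
  open +-*-Solver
  x̄ ẋ : ℕ
  x̄ = # n (complement n x)
  ẋ = # n x
  one : ∀ b → bit (not b) + bit b ≡ 1
  one true  = refl
  one false = refl

fromVec : ∀ {A : Set} {n} → Vec A n → ⟦ Word n ⟧ A
fromVec []       = tt
fromVec (a ∷ as) = a , fromVec as

toVec : ∀ {A : Set} n → ⟦ Word n ⟧ A → Vec A n
toVec zero    _        = []
toVec (suc n) (a , as) = a ∷ toVec n as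

map-fromVec : ∀ {A B : Set} {n} (φ : A → B) (as : Vec A n) →
  mapᵗ (Word n) φ (fromVec as) ≡ fromVec (Vec.map φ as)
map-fromVec φ []       = refl
map-fromVec φ (a ∷ as) = cong (φ a ,_) (map-fromVec φ as)

map-toVec : ∀ {A B : Set} n (φ : A → B) as → Vec.map φ (toVec n as) ≡ toVec n (mapᵗ (Word n) φ as)
map-toVec zero    φ as       = refl
map-toVec (suc n) φ (a , as) = cong (φ a ∷_) (map-toVec n φ as)

fromBits-toVec : ∀ n x → fromBits (toVec n x) ≡ # n x
fromBits-toVec zero    x           = refl
fromBits-toVec (suc n) (true , x)  = cong suc (trans (cong (_* 2) (fromBits-toVec n x)) (*-comm (# n x) 2))
fromBits-toVec (suc n) (false , x) = trans (cong (_* 2) (fromBits-toVec n x)) (*-comm (# n x) 2)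

word : ∀ n → ℕ → Val (Word n)
word n k = fromVec (toBits n k)

#-word : ∀ n {k} → k < 2 ^ n → # n (word n k) ≡ k
#-word zero    k<1 = sym (n<1⇒n≡0 k<1)
#-word (suc n) {k} k<2^ = begin
  bit (Inverse.to 2↔Bool (k mod 2)) + 2 * # n (word n (k / 2)) ≡⟨ cong₂ (λ a b → a + 2 * b) (bit-mod (k mod 2)) (#-word n k/2<) ⟩
  toℕ (k mod 2) + 2 * (k / 2)    ≡⟨ cong₂ _+_ (toℕ-fromℕ< (m%n<n k 2)) (*-comm 2 (k / 2)) ⟩
  k % 2 + k / 2 * 2                ≡⟨ m≡m%n+[m/n]*n k 2 ⟨
  k                                ∎
  where
  open ≡-Reasoning
  k/2< : k / 2 < 2 ^ n
  k/2< = m<n*o⇒m/o<n (<-≤-trans k<2^ (≤-reflexive (*-comm 2 (2 ^ n))))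
  bit-mod : ∀ d → bit (Inverse.to 2↔Bool d) ≡ toℕ d
  bit-mod zero       = refl
  bit-mod (suc zero) = refl

pad : ∀ n p → Val (Word n) → Val (Word (n + p))
pad zero    p x       = word p 0
pad (suc n) p (b , x) = b , pad n p x

#-pad : ∀ n p x → # (n + p) (pad n p x) ≡ # n x
#-pad zero    p x       = #-word p (m^n>0 2 p)
#-pad (suc n) p (b , x) = cong (λ y → bit b + 2 * y) (#-pad n p x)

pad-realised : ∀ n p → Realised (Word n) (Word (n + p)) (pad n p) (bits (Word p))
pad-realised zero    p = constant (Word p) (word p 0)
pad-realised (suc n) p = fork fst (snd ▹ pad-realised n p)

-- Arithmetic

sum carry : Bool → Bool → Bool → Bool
sum   k a b = k xor (a xor b)
carry k a b = (a ∧ b) ∨ (k ∧ (a ∨ b))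

full-adder : ∀ k a b → bit (sum k a b) + 2 * bit (carry k a b) ≡ bit b + bit k + bit a
full-adder true  true  true  = refl
full-adder true  true  false = refl
full-adder true  false true  = refl
full-adder true  false false = refl
full-adder false true  true  = refl
full-adder false true  false = refl
full-adder false false true  = refl
full-adder false false false = refl

-- `K` is fixed when the circuit is built, so each position depends only on the incoming carry and
-- one input bit; sum and carry then cost 16 gates each.
add : ∀ n → Val (Word n) → Val (𝔹 ⊗ Word n) → Val (Word n ⊗ 𝔹)
add zero    _       (c , _)     = tt , c
add (suc n) (k , K) (c , b , x) =
  let (y , o) = add n K (carry k c b , x) in (sum k c b , y) , o

#-add : ∀ n K c x → let (y , o) = add n K (c , x) in
  # n y + 2 ^ n * bit o ≡ # n x + # n K + bit c
#-add zero    _       c _       = +-identityʳ (bit c)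
#-add (suc n) (k , K) c (b , x) = begin
  (S + 2 * Y) + 2 * 2 ^ n * O          ≡⟨ solve 4 (λ S Y P O → (S :+ con 2 :* Y) :+ con 2 :* P :* O := S :+ con 2 :* (Y :+ P :* O)) refl S Y (2 ^ n) O ⟩
  S + 2 * (Y + 2 ^ n * O)              ≡⟨ cong (λ z → S + 2 * z) (#-add n K (carry k c b) x) ⟩
  S + 2 * (# n x + # n K + C)          ≡⟨ solve 4 (λ S X K C → S :+ con 2 :* (X :+ K :+ C) := S :+ con 2 :* C :+ (con 2 :* X :+ con 2 :* K)) refl S (# n x) (# n K) C ⟩
  S + 2 * C + (2 * # n x + 2 * # n K)  ≡⟨ cong (_+ (2 * # n x + 2 * # n K)) (full-adder k c b) ⟩
  bit b + bit k + bit c + (2 * # n x + 2 * # n K) ≡⟨ solve 5 (λ b k c X K → b :+ k :+ c :+ (X :+ K) := b :+ X :+ (k :+ K) :+ c) refl (bit b) (bit k) (bit c) (2 * # n x) (2 * # n K) ⟩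
  bit b + 2 * # n x + (bit k + 2 * # n K) + bit c ∎
  where
  open ≡-Reasoning
  open +-*-Solver
  rest = add n K (carry k c b , x)
  Y O S C : ℕ
  Y = # n (proj₁ rest)
  O = bit (proj₂ rest)
  S = bit (sum k c b)
  C = bit (carry k c b)

add-realised : ∀ n K → Realised (𝔹 ⊗ Word n) (Word n ⊗ 𝔹) (add n K) (n * 32)
add-realised zero    K       = rewire (λ (c , _) → tt , c) (λ _ _ → refl)
add-realised (suc n) (k , K) = relax (≤-reflexive (+-identityʳ (32 + n * 32)))
  (fork (bottom ▹ binary (sum k)) (fork (bottom ▹ binary (carry k)) (snd ▹ snd))
   ▹ fork fst (snd ▹ add-realised n K)
   ▹ rewire (λ (a , (y , o)) → (a , y) , o) (λ _ _ → refl))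
  where
  bottom : Realised (𝔹 ⊗ 𝔹 ⊗ Word n) (𝔹 ⊗ 𝔹) (λ (c , b , _) → c , b) 0
  bottom = rewire (λ (c , b , _) → c , b) (λ _ _ → refl)

-- Subtraction in two's complement: the carry out is set exactly when K ≤ x.
conditionalSub : ∀ n → Val (Word n) → Val (Word n) → Val (𝔹 ⊗ Word n)
conditionalSub n K x =
  let (y , o) = add n (complement n K) (true , x) in o , (if o then y else x)

conditionalSub-realised : ∀ n K →
  Realised (Word n) (𝔹 ⊗ Word n) (conditionalSub n K) (1 + n * 32 + bits (Word n) * 4)
conditionalSub-realised n K =
  (fork here (fork (constant 𝔹 true) here ▹ add-realised n (complement n K))
   ▹ fork (snd ▹ snd) (branch (snd ▹ snd) (snd ▹ fst) fst))

data Subtraction n (K x : Val (Word n)) : Val (𝔹 ⊗ Word n) → Set where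
  fits     : ∀ {y} → # n y + # n K ≡ # n x → Subtraction n K x (true , y)
  too-big  : # n x < # n K → Subtraction n K x (false , x)

-- Adding 2^n - K to x overflows exactly when K ≤ x. In `balance` K stands on the other side, to
-- stay within the naturals; without a carry, X + 2^n = Y + k with Y < 2^n forces X < k.
conditionalSub-correct : ∀ n K x → Subtraction n K x (conditionalSub n K x)
conditionalSub-correct n K x with add n (complement n K) (true , x) | #-add n (complement n K) true x
... | y , o | eq = go o balance
  where
  open +-*-Solver
  X Y k k̄ : ℕ
  X = # n x
  Y = # n y
  k = # n K
  k̄ = # n (complement n K)
  balance : Y + 2 ^ n * bit o + k ≡ X + 2 ^ n
  balance = begin
    Y + 2 ^ n * bit o + k ≡⟨ cong (_+ k) eq ⟩
    X + k̄ + 1 + k         ≡⟨ solve 3 (λ X k̄ k → X :+ k̄ :+ con 1 :+ k := X :+ (k̄ :+ k :+ con 1)) refl X k̄ k ⟩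
    X + (k̄ + k + 1)       ≡⟨ cong (X +_) (#-complement n K) ⟩
    X + 2 ^ n             ∎
    where open ≡-Reasoning
  go : ∀ o → Y + 2 ^ n * bit o + k ≡ X + 2 ^ n → Subtraction n K x (o , (if o then y else x))
  go true bal = fits (+-cancelʳ-≡ (2 ^ n) _ _ (trans
    (solve 3 (λ Y k P → Y :+ k :+ P := Y :+ P :* con 1 :+ k) refl Y k (2 ^ n)) bal))
  go false bal = too-big (+-cancelʳ-< (2 ^ n) X k (begin-strict
    X + 2 ^ n             ≡⟨ bal ⟨
    Y + 2 ^ n * 0 + k     ≡⟨ solve 3 (λ Y k P → Y :+ P :* con 0 :+ k := k :+ Y) refl Y k (2 ^ n) ⟩
    k + Y                 <⟨ +-monoʳ-< k (#-< n y) ⟩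
    k + 2 ^ n             ∎))
    where open ≤-Reasoning

-- The product of the multipliers h selected by an index, not reduced modulo N.
evaluate : List (ℕ × ℕ) → ℕ → ℕ
evaluate []             i = 1
evaluate ((T , h) ∷ ss) i = if T ≤ᵇ i then h * evaluate ss (i ∸ T) else evaluate ss i

evaluate-≥ : ∀ {T h ss i} → T ≤ i → evaluate ((T , h) ∷ ss) i ≡ h * evaluate ss (i ∸ T)
evaluate-≥ {T} {i = i} T≤i with T ≤ᵇ i | ≤⇒≤ᵇ T≤i
... | true | _ = refl

evaluate-< : ∀ {T h ss i} → i < T → evaluate ((T , h) ∷ ss) i ≡ evaluate ss i
evaluate-< {T} {i = i} i<T with T ≤ᵇ i | ≤ᵇ⇒≤ T i
... | true  | T≤i = contradiction (T≤i tt) (<⇒≱ i<T)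
... | false | _   = refl

-- Arithmetic modulo N on words

module Modular (N : ℕ) ⦃ _ : NonZero N ⦄ (W : ℕ) (2N≤2^W : 2 * N ≤ 2 ^ W) where

  N<2^W : N < 2 ^ W
  N<2^W = <-≤-trans (≤-trans (+-monoˡ-≤ N (>-nonZero⁻¹ N)) (≤-reflexive (cong (N +_) (sym (+-identityʳ N))))) 2N≤2^W

  modulus : Val (Word W)
  modulus = word W N

  -- The width leaves a spare bit: two residues sum to less than 2N ≤ 2^W, so the carry is zero and
  -- may be dropped, and one conditional subtraction reduces the sum.
  addMod : ℕ → Val (Word W) → Val (Word W)
  addMod c x = proj₂ (conditionalSub W modulus (proj₁ (add W (word W (c % N)) (false , x))))

  addMod-cost = 1 + W * 32 + (1 + W * 32 + bits (Word W) * 4)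

  addMod-realised : ∀ c → Realised (Word W) (Word W) (addMod c) addMod-cost
  addMod-realised c = relax (≤-reflexive (trans (+-identityʳ _) (cong (λ z → z + (1 + W * 32 + bits (Word W) * 4)) (+-identityʳ (1 + W * 32)))))
    (fork (constant 𝔹 false) here ▹ add-realised W (word W (c % N)) ▹ fst
     ▹ conditionalSub-realised W modulus ▹ snd)

  reduceOnce : ∀ {y r k} → Subtraction W modulus y r → # W y ≡ k → k < N + N → # W (proj₂ r) ≡ k % N
  reduceOnce {y} (fits {z} z+N≡y) refl y<2N = begin
    # W z           ≡⟨ m<n⇒m%n≡m (+-cancelʳ-< N _ _ (≤-<-trans (≤-reflexive total) y<2N)) ⟨
    # W z % N       ≡⟨ [m+n]%n≡m%n (# W z) N ⟨
    (# W z + N) % N ≡⟨ cong (_% N) total ⟩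
    # W y % N       ∎
    where
    open ≡-Reasoning
    total : # W z + N ≡ # W y
    total = trans (cong (# W z +_) (sym (#-word W N<2^W))) z+N≡y
  reduceOnce (too-big y<N) refl _ =
    sym (m<n⇒m%n≡m (<-≤-trans y<N (≤-reflexive (#-word W N<2^W))))

  #-addMod : ∀ c x → # W x < N → # W (addMod c x) ≡ (# W x + c) % N
  #-addMod c x x<N with add W (word W (c % N)) (false , x) | #-add W (word W (c % N)) false x
  ... | y , o | eq = trans (go o eq₁) c%N
    where
    d : ℕ
    d = c % N
    d<N : d < N
    d<N = m%n<n c N
    #d : # W (word W d) ≡ d
    #d = #-word W (<-trans d<N N<2^W)
    eq₁ : # W y + 2 ^ W * bit o ≡ # W x + d
    eq₁ = trans eq (trans (+-identityʳ _) (cong (# W x +_) #d))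
    c%N : (# W x + d) % N ≡ (# W x + c) % N
    c%N = trans (%-distribˡ-+ (# W x) d N) (trans (cong (λ z → (# W x % N + z) % N) (m%n%n≡m%n c N)) (sym (%-distribˡ-+ (# W x) c N)))
    go : ∀ o → # W y + 2 ^ W * bit o ≡ # W x + d → # W (proj₂ (conditionalSub W modulus y)) ≡ (# W x + d) % N
    go true eq₁ = contradiction (≤-reflexive eq₁) (<⇒≱ (begin-strict
      # W x + d             <⟨ +-mono-< x<N d<N ⟩
      N + N                 ≡⟨ cong (N +_) (+-identityʳ N) ⟨
      2 * N                 ≤⟨ 2N≤2^W ⟩
      2 ^ W                 ≡⟨ *-identityʳ (2 ^ W) ⟨
      2 ^ W * 1             ≤⟨ m≤n+m _ (# W y) ⟩
      # W y + 2 ^ W * 1     ∎))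
      where open ≤-Reasoning
    go false eq₁ = reduceOnce (conditionalSub-correct W modulus y)
      (trans (sym (trans (cong (# W y +_) (*-zeroʳ (2 ^ W))) (+-identityʳ _))) eq₁) (+-mono-< x<N d<N)

  -- Shift-and-add computing a + c * x modulo N. The shift acts on the constant c and not on the
  -- accumulator, so the circuit only ever adds constants.
  mulAdd : ∀ n → ℕ → Val (Word n ⊗ Word W) → Val (Word W)
  mulAdd zero    c (_ , a)       = a
  mulAdd (suc n) c ((b , x) , a) = mulAdd n (2 * c) (x , (if b then addMod c a else a))

  #-mulAdd : ∀ n c x a → # W a < N → # W (mulAdd n c (x , a)) ≡ (# W a + c * # n x) % N
  #-mulAdd zero    c x a a<N = trans (sym (m<n⇒m%n≡m a<N))
    (cong (_% N) (sym (trans (cong (# W a +_) (*-zeroʳ c)) (+-identityʳ _))))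
  #-mulAdd (suc n) c (true , x) a a<N = begin
    # W (mulAdd n (2 * c) (x , addMod c a))          ≡⟨ #-mulAdd n (2 * c) x _ (≤-<-trans (≤-reflexive (#-addMod c a a<N)) (m%n<n _ N)) ⟩
    (# W (addMod c a) + 2 * c * # n x) % N           ≡⟨ cong (λ z → (z + 2 * c * # n x) % N) (#-addMod c a a<N) ⟩
    ((# W a + c) % N + 2 * c * # n x) % N            ≡⟨ %-distribˡ-+ _ (2 * c * # n x) N ⟩
    ((# W a + c) % N % N + 2 * c * # n x % N) % N    ≡⟨ cong (λ z → (z + 2 * c * # n x % N) % N) (m%n%n≡m%n (# W a + c) N) ⟩
    ((# W a + c) % N + 2 * c * # n x % N) % N        ≡⟨ %-distribˡ-+ (# W a + c) (2 * c * # n x) N ⟨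
    (# W a + c + 2 * c * # n x) % N                  ≡⟨ cong (_% N) (solve 3 (λ a c x → a :+ c :+ con 2 :* c :* x := a :+ c :* (con 1 :+ con 2 :* x)) refl (# W a) c (# n x)) ⟩
    (# W a + c * (1 + 2 * # n x)) % N                ∎
    where
    open ≡-Reasoning
    open +-*-Solver
  #-mulAdd (suc n) c (false , x) a a<N = trans (#-mulAdd n (2 * c) x a a<N)
    (cong (λ z → (# W a + z) % N) (solve 2 (λ c x → con 2 :* c :* x := c :* (con 2 :* x)) refl c (# n x)))
    where open +-*-Solver

  mulAdd-cost = addMod-cost + bits (Word W) * 4

  mulAdd-realised : ∀ n c → Realised (Word n ⊗ Word W) (Word W) (mulAdd n c) (n * mulAdd-cost)
  mulAdd-realised zero    c = snd
  mulAdd-realised (suc n) c = relax (≤-reflexive (cong (λ z → z + bits (Word W) * 4 + n * mulAdd-cost) (+-identityʳ addMod-cost)))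
    (fork (rewire (λ ((_ , x) , _) → x) (λ _ _ → refl))
          (branch (fst ▹ fst) (snd ▹ addMod-realised c) snd)
     ▹ mulAdd-realised n (2 * c))

  zeros : Val (Word W)
  zeros = word W 0

  #-zeros : # W zeros ≡ 0
  #-zeros = #-word W (≤-<-trans z≤n N<2^W)

  module _ (A : ℕ) where

    step : ℕ × ℕ → Val (Word A ⊗ Word W) → Val (Word A ⊗ Word W)
    step (T , h) (i , z) =
      let (o , j) = conditionalSub A (word A T) i in j , (if o then mulAdd W h (z , zeros) else z)

    -- Invariant: modulo N, the accumulator times `evaluate` of the remaining steps at the remaining
    -- index does not change. Correctness is therefore proved for an arbitrary reduced starting
    -- accumulator.
    run : List (ℕ × ℕ) → Val (Word A ⊗ Word W) → Val (Word A ⊗ Word W)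
    run []       x = x
    run (s ∷ ss) x = run ss (step s x)

    #-run : ∀ {ss} → All (λ s → proj₁ s < 2 ^ A) ss → ∀ i z → # W z < N →
      # W (proj₂ (run ss (i , z))) ≡ (# W z * evaluate ss (# A i)) % N
    #-run [] i z z<N = sym (trans (cong (_% N) (*-identityʳ (# W z))) (m<n⇒m%n≡m z<N))
    #-run {(T , h) ∷ ss} (T< ∷ bounds) i z z<N
      = go (conditionalSub-correct A (word A T) i)
      where
      open ≡-Reasoning
      open +-*-Solver
      #T : # A (word A T) ≡ T
      #T = #-word A T<
      go : ∀ {r} → Subtraction A (word A T) i r →
        # W (proj₂ (run ss (proj₂ r , (if proj₁ r then mulAdd W h (z , zeros) else z)))) ≡
        (# W z * evaluate ((T , h) ∷ ss) (# A i)) % N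
      go (too-big i<T) = trans (#-run bounds i z z<N)
        (cong (λ e → (# W z * e) % N) (sym (evaluate-< {h = h} {ss} (<-≤-trans i<T (≤-reflexive #T)))))
      go (fits {j} j+T≡i) = begin
        # W (proj₂ (run ss (j , hz)))                                  ≡⟨ #-run bounds j hz (≤-<-trans (≤-reflexive #hz) (m%n<n _ N)) ⟩
        (# W hz * evaluate ss (# A j)) % N                            ≡⟨ cong (λ e → (e * evaluate ss (# A j)) % N) #hz ⟩
        ((h * # W z) % N * evaluate ss (# A j)) % N                    ≡⟨ %-distribˡ-* _ (evaluate ss (# A j)) N ⟩
        ((h * # W z) % N % N * (evaluate ss (# A j) % N)) % N          ≡⟨ cong (λ e → (e * (evaluate ss (# A j) % N)) % N) (m%n%n≡m%n (h * # W z) N) ⟩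
        ((h * # W z) % N * (evaluate ss (# A j) % N)) % N              ≡⟨ %-distribˡ-* (h * # W z) (evaluate ss (# A j)) N ⟨
        (h * # W z * evaluate ss (# A j)) % N                          ≡⟨ cong (_% N) (solve 3 (λ h z e → h :* z :* e := z :* (h :* e)) refl h (# W z) (evaluate ss (# A j))) ⟩
        (# W z * (h * evaluate ss (# A j))) % N                        ≡⟨ cong (λ k → (# W z * (h * evaluate ss k)) % N) j≡i∸T ⟩
        (# W z * (h * evaluate ss (# A i ∸ T))) % N                    ≡⟨ cong (λ e → (# W z * e) % N) (sym (evaluate-≥ {h = h} {ss} T≤i)) ⟩
        (# W z * evaluate ((T , h) ∷ ss) (# A i)) % N                  ∎
        where
        hz : Val (Word W)
        hz = mulAdd W h (z , zeros)
        #hz : # W hz ≡ (h * # W z) % N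
        #hz = trans (#-mulAdd W h z zeros (≤-<-trans (≤-reflexive #-zeros) (>-nonZero⁻¹ N)))
          (cong (λ a → (a + h * # W z) % N) #-zeros)
        total : # A j + T ≡ # A i
        total = trans (cong (# A j +_) (sym #T)) j+T≡i
        T≤i : T ≤ # A i
        T≤i = ≤-trans (m≤n+m T (# A j)) (≤-reflexive total)
        j≡i∸T : # A j ≡ # A i ∸ T
        j≡i∸T = trans (sym (m+n∸n≡m (# A j) T)) (cong (_∸ T) total)

    step-cost = 1 + A * 32 + bits (Word A) * 4 + (bits (Word W) + W * mulAdd-cost + bits (Word W) * 4)

    step-realised : ∀ s → Realised (Word A ⊗ Word W) (Word A ⊗ Word W) (step s) step-cost
    step-realised (T , h) = relax (≤-reflexive (cong₂ (λ a b → a + (b + bits (Word W) * 4)) (+-identityʳ subtraction-cost) (+-identityʳ _)))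
      (fork (fst ▹ conditionalSub-realised A (word A T)) snd
       ▹ fork (fst ▹ snd) (branch (fst ▹ fst) (fork snd (constant (Word W) zeros) ▹ mulAdd-realised W h) snd))
      where subtraction-cost = 1 + A * 32 + bits (Word A) * 4

    run-realised : ∀ ss → Realised (Word A ⊗ Word W) (Word A ⊗ Word W) (run ss) (length ss * step-cost)
    run-realised []       = here
    run-realised (s ∷ ss) = step-realised s ▹ run-realised ss

compile : ∀ {n m f} → Realised (Word n) (Word m) f s →
  Σ[ C ∈ Circuit n m ] circuitSize C ≤ n + s + m ×
    (∀ x → fromBits (eval C x) ≡ # m (f (fromVec x)))
compile {n = n} {m} {f} F with F .build [] (fromVec (Vec.allFin n))
... | E , o , ok = circuit (gates E) (toVec m o) , +-monoˡ-≤ m (wires≤ E) , correct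
  where
  open ≡-Reasoning
  correct : ∀ x → fromBits (eval (circuit (gates E) (toVec m o)) x) ≡ # m (f (fromVec x))
  correct x = begin
    fromBits (Vec.map (lookup (evalGates (gates E) x)) (toVec m o)) ≡⟨ cong fromBits (map-toVec m _ o) ⟩
    fromBits (toVec m (read (Word m) (gates E) o x))                ≡⟨ fromBits-toVec m _ ⟩
    # m (read (Word m) (gates E) o x)                               ≡⟨ cong (# m) (ok x) ⟩
    # m (f (mapᵗ (Word n) (lookup x) (fromVec (Vec.allFin n))))     ≡⟨ cong (# m ∘ f) (map-fromVec (lookup x) (Vec.allFin n)) ⟩
    # m (f (fromVec (Vec.map (lookup x) (Vec.allFin n))))           ≡⟨ cong (# m ∘ f ∘ fromVec) (map-lookup-allFin x) ⟩
    # m (f (fromVec x))                                             ∎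

-- Chains of subgroups

least : ∀ {P : Pred ℕ 0ℓ} → Decidable P → ∀ n → P n → ∃[ m ] m ≤ n × P m × (∀ {k} → k < m → ¬ P k)
least {P} P? n Pn with below (suc n)
  where
  below : ∀ n → (∃[ m ] m < n × P m × (∀ {k} → k < m → ¬ P k)) ⊎ (∀ {k} → k < n → ¬ P k)
  below zero = inj₂ λ ()
  below (suc n) with below n
  ... | inj₁ (m , m<n , rest) = inj₁ (m , m≤n⇒m≤1+n m<n , rest)
  ... | inj₂ none with P? n
  ...   | yes Pn = inj₁ (n , ≤-refl , Pn , none)
  ...   | no ¬Pn = inj₂ λ k≤n → λ Pk → case m≤n⇒m<n∨m≡n (≤-pred k≤n) of λ where
            (inj₁ k<n)  → none k<n Pk
            (inj₂ refl) → ¬Pn Pk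
... | inj₁ (m , s≤s m≤n , rest) = m , m≤n , rest
... | inj₂ none = contradiction Pn (none ≤-refl)

-- The largest threshold comes first, so that greedy subtraction reads the binary digits of the
-- exponent from the top.
block : ℕ → ℕ → ℕ → List (ℕ × ℕ)
block M g zero    = []
block M g (suc t) = (M * 2 ^ t , g ^ (2 ^ t)) ∷ block M g t

length-block : ∀ M g t → length (block M g t) ≡ t
length-block M g zero    = refl
length-block M g (suc t) = cong suc (length-block M g t)

-- Every block of a chain has ℓ steps whatever its radix, so thresholds may exceed N; 2ℓ bits hold
-- them all.
block-< : ∀ {M ℓ} g → M ≤ 2 ^ ℓ → ∀ {t} → t ≤ ℓ → All (λ s → proj₁ s < 2 ^ (ℓ + ℓ)) (block M g t)
block-< g M≤ {zero}  _ = []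
block-< {M} {ℓ} g M≤ {suc t} t<ℓ = (begin-strict
  M * 2 ^ t     ≤⟨ *-monoˡ-≤ (2 ^ t) M≤ ⟩
  2 ^ ℓ * 2 ^ t ≡⟨ ^-distribˡ-+-* 2 ℓ t ⟨
  2 ^ (ℓ + t)   <⟨ ^-monoʳ-< 2 (s≤s (s≤s z≤n)) (+-monoʳ-< ℓ t<ℓ) ⟩
  2 ^ (ℓ + ℓ)   ∎) ∷ block-< g M≤ (<⇒≤ t<ℓ)
  where open ≤-Reasoning

-- As a < M, the index reaches the threshold for the bit 2^t exactly when q ≥ 2^t, that is, when
-- this bit of q is set. Induction on t strips the bits and leaves a for `ss`.
evaluate-block : ∀ {M} g ss t {q a} → a < M → q < 2 ^ t →
  evaluate (block M g t ++ ss) (a + q * M) ≡ g ^ q * evaluate ss a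
evaluate-block {M} g ss zero {a = a} a<M (s≤s z≤n) =
  trans (cong (evaluate ss) (+-identityʳ a)) (sym (+-identityʳ _))
evaluate-block {M} g ss (suc t) {q} {a} a<M q< with q <? 2 ^ t
... | yes q<2^t = trans (evaluate-< {h = g ^ 2 ^ t} {block M g t ++ ss} (begin-strict
    a + q * M   <⟨ +-monoˡ-< (q * M) a<M ⟩
    suc q * M   ≤⟨ *-monoˡ-≤ M q<2^t ⟩
    2 ^ t * M   ≡⟨ *-comm (2 ^ t) M ⟩
    M * 2 ^ t   ∎)) (evaluate-block g ss t a<M q<2^t)
  where open ≤-Reasoning
... | no q≮2^t = begin
    evaluate (block M g (suc t) ++ ss) (a + q * M)      ≡⟨ evaluate-≥ {h = g ^ 2 ^ t} {block M g t ++ ss} (≤-trans (m≤n+m T (a + p * M)) (≤-reflexive (sym split))) ⟩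
    g ^ 2 ^ t * evaluate rest (a + q * M ∸ T)           ≡⟨ cong (λ i → g ^ 2 ^ t * evaluate rest i) (trans (cong (_∸ T) split) (m+n∸n≡m (a + p * M) T)) ⟩
    g ^ 2 ^ t * evaluate rest (a + p * M)               ≡⟨ cong (g ^ 2 ^ t *_) (evaluate-block g ss t a<M p<2^t) ⟩
    g ^ 2 ^ t * (g ^ p * evaluate ss a)                 ≡⟨ *-assoc (g ^ 2 ^ t) (g ^ p) _ ⟨
    g ^ 2 ^ t * g ^ p * evaluate ss a                   ≡⟨ cong (_* evaluate ss a) (^-distribˡ-+-* g (2 ^ t) p) ⟨
    g ^ (2 ^ t + p) * evaluate ss a                     ≡⟨ cong (λ e → g ^ e * evaluate ss a) q≡ ⟩
    g ^ q * evaluate ss a                               ∎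
  where
  open ≡-Reasoning
  open +-*-Solver
  T p : ℕ
  T = M * 2 ^ t
  p = q ∸ 2 ^ t
  rest : List (ℕ × ℕ)
  rest = block M g t ++ ss
  q≡ : 2 ^ t + p ≡ q
  q≡ = m+[n∸m]≡n (≮⇒≥ q≮2^t)
  p<2^t : p < 2 ^ t
  p<2^t = +-cancelˡ-< (2 ^ t) p (2 ^ t) (≤-<-trans (≤-reflexive q≡) (<-≤-trans q< (≤-reflexive (cong (2 ^ t +_) (+-identityʳ (2 ^ t))))))
  split : a + q * M ≡ a + p * M + T
  split = trans (cong (λ q → a + q * M) (sym q≡))
    (solve 4 (λ a P p M → a :+ (P :+ p) :* M := a :+ p :* M :+ M :* P) refl a (2 ^ t) p M)

k<2^k : ∀ k → k < 2 ^ k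
k<2^k zero    = ≤-refl
k<2^k (suc k) = begin-strict
  suc k         ≤⟨ k<2^k k ⟩
  2 ^ k         <⟨ m<m+n (2 ^ k) (m^n>0 2 k) ⟩
  2 ^ k + 2 ^ k ≡⟨ cong (2 ^ k +_) (+-identityʳ (2 ^ k)) ⟨
  2 ^ suc k     ∎
  where open ≤-Reasoning

-- Congruence modulo N

module Congruence (N : ℕ) ⦃ _ : NonZero N ⦄ where

  infix 4 _≈_
  _≈_ : ℕ → ℕ → Set
  a ≈ b = a % N ≡ b % N

  *-cong-≈ : ∀ {a b c d} → a ≈ b → c ≈ d → a * c ≈ b * d
  *-cong-≈ {a} {b} {c} {d} a≈b c≈d = begin
    a * c % N                 ≡⟨ %-distribˡ-* a c N ⟩
    (a % N) * (c % N) % N     ≡⟨ cong₂ (λ x y → x * y % N) a≈b c≈d ⟩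
    (b % N) * (d % N) % N     ≡⟨ %-distribˡ-* b d N ⟨
    b * d % N                 ∎
    where open ≡-Reasoning

  ≈⇒∣ : ∀ a b → a ≈ b → N ∣ ∣ a - b ∣
  ≈⇒∣ a b a≈b = divides ∣ a / N - b / N ∣ (begin
    ∣ a - b ∣                                        ≡⟨ cong₂ ∣_-_∣ (m≡m%n+[m/n]*n a N) (m≡m%n+[m/n]*n b N) ⟩
    ∣ a % N + a / N * N - b % N + b / N * N ∣        ≡⟨ cong (λ r → ∣ a % N + a / N * N - r + b / N * N ∣) (sym a≈b) ⟩
    ∣ a % N + a / N * N - a % N + b / N * N ∣        ≡⟨ ∣m+n-m+o∣≡∣n-o∣ (a % N) _ _ ⟩
    ∣ a / N * N - b / N * N ∣                        ≡⟨ *-distribʳ-∣-∣ N (a / N) (b / N) ⟨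
    ∣ a / N - b / N ∣ * N                            ∎)
    where open ≡-Reasoning

  ∣⇒≈-≤ : ∀ a b → a ≤ b → N ∣ ∣ a - b ∣ → a ≈ b
  ∣⇒≈-≤ a b a≤b (divides c eq) = begin
    a % N           ≡⟨ [m+kn]%n≡m%n a c N ⟨
    (a + c * N) % N ≡⟨ cong (λ d → (a + d) % N) (trans (sym eq) (m≤n⇒∣m-n∣≡n∸m a≤b)) ⟩
    (a + (b ∸ a)) % N ≡⟨ cong (_% N) (m+[n∸m]≡n a≤b) ⟩
    b % N           ∎
    where open ≡-Reasoning

  ∣⇒≈ : ∀ a b → N ∣ ∣ a - b ∣ → a ≈ b
  ∣⇒≈ a b N∣ with ≤-total a b
  ... | inj₁ a≤b = ∣⇒≈-≤ a b a≤b N∣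
  ... | inj₂ b≤a = sym (∣⇒≈-≤ b a b≤a (subst (N ∣_) (∣-∣-comm a b) N∣))

-- The assumptions are those of a finite commutative cancellative monoid modulo N; `order` supplies
-- inverses as powers. `Q` ranges over all naturals and respects congruence, because `evaluate` does
-- not reduce its products.
module Chains
  (N : ℕ) ⦃ _ : NonZero N ⦄
  (Q : Pred ℕ 0ℓ) (Q? : Decidable Q)
  (Q-resp : ∀ {a b} → a % N ≡ b % N → Q a → Q b)
  (Q-1 : Q 1) (Q-* : ∀ {a b} → Q a → Q b → Q (a * b))
  (Q-cancel : ∀ {x a b} → Q x → (x * a) % N ≡ (x * b) % N → a % N ≡ b % N)
  (ℓ : ℕ) (N≤2^ℓ : N ≤ 2 ^ ℓ)
  where

  open Congruence N

  Q-^ : ∀ {a} → Q a → ∀ k → Q (a ^ k)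
  Q-^ q zero    = Q-1
  Q-^ q (suc k) = Q-* q (Q-^ q k)

  -- Among the N + 1 powers a^0, ..., a^N two agree modulo N, and the smaller one cancels. As the
  -- exponent is `suc e`, a^e is an inverse of a.
  order : ∀ {a} → Q a → ∃[ e ] suc e ≤ N × a ^ suc e ≈ 1
  order {a} Qa with pigeonhole {m = N} {n = suc N} ≤-refl (λ i → fromℕ< (m%n<n (a ^ toℕ i) N))
  ... | i , j , i<j , eq = toℕ j ∸ suc (toℕ i) , bound , Q-cancel (Q-^ Qa (toℕ i)) power
    where
    open ≡-Reasoning
    d : ℕ
    d = toℕ j ∸ suc (toℕ i)
    j≡ : toℕ i + suc d ≡ toℕ j
    j≡ = trans (+-suc (toℕ i) d) (m+[n∸m]≡n i<j)
    bound : suc d ≤ N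
    bound = ≤-trans (m≤n+m (suc d) (toℕ i)) (≤-trans (≤-reflexive j≡) (≤-pred (toℕ<n j)))
    power : a ^ toℕ i * a ^ suc d ≈ a ^ toℕ i * 1
    power = begin
      (a ^ toℕ i * a ^ suc d) % N ≡⟨ cong (_% N) (^-distribˡ-+-* a (toℕ i) (suc d)) ⟨
      a ^ (toℕ i + suc d) % N     ≡⟨ cong (λ e → a ^ e % N) j≡ ⟩
      a ^ toℕ j % N               ≡⟨ toℕ-fromℕ< _ ⟨
      toℕ (fromℕ< (m%n<n (a ^ toℕ j) N)) ≡⟨ cong toℕ eq ⟨
      toℕ (fromℕ< (m%n<n (a ^ toℕ i) N)) ≡⟨ toℕ-fromℕ< _ ⟩
      a ^ toℕ i % N               ≡⟨ cong (_% N) (*-identityʳ (a ^ toℕ i)) ⟨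
      (a ^ toℕ i * 1) % N         ∎

  Image : List (ℕ × ℕ) → ℕ → Pred ℕ 0ℓ
  Image ss M v = ∃[ i ] i < M × evaluate ss i ≈ v

  -- Only the top subgroup is kept, as the residues of `evaluate steps` at indices below `size`.
  -- Closure under products and containing 1 suffice for a subgroup, since every member has finite
  -- order.
  record Chain (k : ℕ) : Set where
    field
      size      : ℕ
      steps     : List (ℕ × ℕ)
      injective : ∀ {i j} → i < size → j < size → evaluate steps i ≈ evaluate steps j → i ≡ j
      member    : ∀ {i} → i < size → Q (evaluate steps i)
      one       : Image steps size 1
      mul       : ∀ {a b} → Image steps size a → Image steps size b → Image steps size (a * b)
      bounded   : All (λ s → proj₁ s < 2 ^ (ℓ + ℓ)) steps
      length≡   : length steps ≡ k * ℓ
      2^k≤size  : 2 ^ k ≤ size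

    size≤N : size ≤ N
    size≤N = injective⇒≤ {f = λ i → fromℕ< (m%n<n (evaluate steps (toℕ i)) N)} λ {i} {j} eq →
      toℕ-injective (injective (toℕ<n i) (toℕ<n j)
        (trans (sym (toℕ-fromℕ< _)) (trans (cong toℕ eq) (toℕ-fromℕ< _))))

    image? : Decidable (Image steps size)
    image? v = anyUpTo? (λ i → evaluate steps i % N ≟ v % N) size

    image-^ : ∀ {a} → Image steps size a → ∀ k → Image steps size (a ^ k)
    image-^ im zero    = one
    image-^ im (suc k) = mul im (image-^ im k)

    image-resp : ∀ {a b} → a ≈ b → Image steps size a → Image steps size b
    image-resp a≈b (i , i< , eq) = i , i< , trans eq a≈b

    image-evaluate : ∀ {i} → i < size → Image steps size (evaluate steps i)
    image-evaluate i< = _ , i< , refl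

  trivial : Chain 0
  trivial = record
    { size = 1 ; steps = [] ; injective = λ { (s≤s z≤n) (s≤s z≤n) _ → refl }
    ; member = λ _ → Q-1 ; one = 0 , s≤s z≤n , refl
    ; mul = λ { (_ , _ , a) (_ , _ , b) → 0 , s≤s z≤n , *-cong-≈ a b }
    ; bounded = [] ; length≡ = refl ; 2^k≤size = ≤-refl }

  -- The least exponent r is `suc m`. `1 ≤ m` makes r at least 2, which doubles the size, and the
  -- bound by 2^ℓ lets every digit q < r fit into ℓ bits.
  module Extend {k} (C : Chain k) {g} (Qg : Q g)
    (m : ℕ) (1≤m : 1 ≤ m) (r≤2^ℓ : suc m ≤ 2 ^ ℓ)
    (g^r∈ : Image (Chain.steps C) (Chain.size C) (g ^ suc m))
    (minimal : ∀ {k} → k < m → ¬ Image (Chain.steps C) (Chain.size C) (g ^ suc k))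
    where

    open Chain C renaming (size to M; steps to ss)

    F : ℕ → ℕ
    F = evaluate ss

    r : ℕ
    r = suc m

    steps′ : List (ℕ × ℕ)
    steps′ = block M g ℓ ++ ss

    evaluate′ : ∀ {q a} → a < M → q < r → evaluate steps′ (a + q * M) ≡ g ^ q * F a
    evaluate′ a<M q<r = evaluate-block g ss ℓ a<M (<-≤-trans q<r r≤2^ℓ)

    data Mixed : ℕ → Set where
      mixed : ∀ {a} q → a < M → q < r → Mixed (a + q * M)

    toMixed : ∀ {i} → i < r * M → Mixed i
    toMixed {i} i< = subst Mixed (sym (m≡m%n+[m/n]*n i M)) (mixed (i / M) (m%n<n i M) (m<n*o⇒m/o<n i<))
      where instance
        M≢0 : NonZero M
        M≢0 = m*n≢0⇒n≢0 r ⦃ >-nonZero (≤-<-trans z≤n i<) ⦄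

    fromMixed-< : ∀ {q a} → a < M → q < r → a + q * M < r * M
    fromMixed-< {q} a<M q<r = <-≤-trans (+-monoˡ-< (q * M) a<M) (*-monoˡ-≤ M q<r)

    -- Two representations g^q h = g^t h′ with q ≤ t give g^(t-q) = h h′⁻¹, where h′⁻¹ is a power of h′,
    -- so t - q = 0 by minimality of r.
    unique-≤ : ∀ {q t a b} → q ≤ t → t < r → a < M → b < M → g ^ q * F a ≈ g ^ t * F b → q ≡ t × a ≡ b
    unique-≤ {q} {t} {a} {b} q≤t t<r a<M b<M eq = finish (t ∸ q) d∈ refl
      where
      d : ℕ
      d = t ∸ q
      Fa≈ : F a ≈ g ^ d * F b
      Fa≈ = Q-cancel (Q-^ Qg q) (trans eq (cong (_% N) (begin
        g ^ t * F b           ≡⟨ cong (λ e → g ^ e * F b) (m+[n∸m]≡n q≤t) ⟨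
        g ^ (q + d) * F b     ≡⟨ cong (_* F b) (^-distribˡ-+-* g q d) ⟩
        g ^ q * g ^ d * F b   ≡⟨ *-assoc (g ^ q) (g ^ d) (F b) ⟩
        g ^ q * (g ^ d * F b) ∎)))
        where open ≡-Reasoning
      e : ℕ
      e = proj₁ (order (member b<M))
      d∈ : Image ss M (g ^ d)
      d∈ = image-resp (begin
        (F a * F b ^ e) % N           ≡⟨ *-cong-≈ {c = F b ^ e} Fa≈ refl ⟩
        (g ^ d * F b * F b ^ e) % N   ≡⟨ cong (_% N) (*-assoc (g ^ d) (F b) (F b ^ e)) ⟩
        (g ^ d * F b ^ suc e) % N     ≡⟨ *-cong-≈ {a = g ^ d} refl (proj₂ (proj₂ (order (member b<M)))) ⟩
        (g ^ d * 1) % N               ≡⟨ cong (_% N) (*-identityʳ (g ^ d)) ⟩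
        g ^ d % N                     ∎)
        (mul (image-evaluate a<M) (image-^ (image-evaluate b<M) e))
        where open ≡-Reasoning
      finish : ∀ d → Image ss M (g ^ d) → t ∸ q ≡ d → q ≡ t × a ≡ b
      finish zero    _  d≡0 = ≤-antisym q≤t (m∸n≡0⇒m≤n d≡0) ,
        injective a<M b<M (trans Fa≈ (cong (_% N) (trans (cong (λ d → g ^ d * F b) d≡0) (*-identityˡ (F b)))))
      finish (suc d) im d≡  = contradiction im (minimal (≤-pred (≤-<-trans (≤-trans (≤-reflexive (sym d≡)) (m∸n≤m t q)) t<r)))

    unique : ∀ {q t a b} → q < r → t < r → a < M → b < M → g ^ q * F a ≈ g ^ t * F b → a + q * M ≡ b + t * M
    unique {q} {t} q<r t<r a<M b<M eq with ≤-total q t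
    ... | inj₁ q≤t = let (q≡t , a≡b) = unique-≤ q≤t t<r a<M b<M eq in cong₂ (λ a q → a + q * M) a≡b q≡t
    ... | inj₂ t≤q = let (t≡q , b≡a) = unique-≤ t≤q q<r b<M a<M (sym eq) in sym (cong₂ (λ a q → a + q * M) b≡a t≡q)

    injective′ : ∀ {i j} → i < r * M → j < r * M → evaluate steps′ i ≈ evaluate steps′ j → i ≡ j
    injective′ i< j< = go (toMixed i<) (toMixed j<)
      where
      go : ∀ {i j} → Mixed i → Mixed j → evaluate steps′ i ≈ evaluate steps′ j → i ≡ j
      go (mixed q a<M q<r) (mixed t b<M t<r) eq = unique q<r t<r a<M b<M
        (trans (sym (cong (_% N) (evaluate′ a<M q<r))) (trans eq (cong (_% N) (evaluate′ b<M t<r))))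

    member′ : ∀ {i} → i < r * M → Q (evaluate steps′ i)
    member′ i< = go (toMixed i<)
      where
      go : ∀ {i} → Mixed i → Q (evaluate steps′ i)
      go (mixed q a<M q<r) = subst Q (sym (evaluate′ a<M q<r)) (Q-* (Q-^ Qg q) (member a<M))

    coset⊆ : ∀ {q v} → q < r → Image ss M v → Image steps′ (r * M) (g ^ q * v)
    coset⊆ {q} q<r (a , a<M , Fa≈v) = a + q * M , fromMixed-< a<M q<r ,
      trans (cong (_% N) (evaluate′ a<M q<r)) (*-cong-≈ {a = g ^ q} refl Fa≈v)

    resp′ : ∀ {u v} → u ≈ v → Image steps′ (r * M) u → Image steps′ (r * M) v
    resp′ u≈v (i , i< , eq) = i , i< , trans eq u≈v

    one′ : Image steps′ (r * M) 1
    one′ = coset⊆ {0} (s≤s z≤n) one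

    -- The exponents add up to less than 2r, so at most one reduction by r is needed; the surplus
    -- g^r lies in the old subgroup and is absorbed there.
    mul-mixed : ∀ {i j u v} → Mixed i → Mixed j →
      evaluate steps′ i ≈ u → evaluate steps′ j ≈ v → Image steps′ (r * M) (u * v)
    mul-mixed {u = u} {v} (mixed {a} q a<M q<r) (mixed {b} t b<M t<r) Fi≈u Fj≈v = resp′ uv≈ (wrap (q + t <? r))
      where
      open +-*-Solver
      FaFb∈ : Image ss M (F a * F b)
      FaFb∈ = mul (image-evaluate a<M) (image-evaluate b<M)
      uv≈ : g ^ (q + t) * (F a * F b) ≈ u * v
      uv≈ = trans (cong (_% N) (trans (cong (_* (F a * F b)) (^-distribˡ-+-* g q t))
          (solve 4 (λ x y a b → x :* y :* (a :* b) := x :* a :* (y :* b)) refl (g ^ q) (g ^ t) (F a) (F b))))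
        (*-cong-≈ (trans (sym (cong (_% N) (evaluate′ a<M q<r))) Fi≈u) (trans (sym (cong (_% N) (evaluate′ b<M t<r))) Fj≈v))
      wrap : Dec (q + t < r) → Image steps′ (r * M) (g ^ (q + t) * (F a * F b))
      wrap (yes q+t<r) = coset⊆ q+t<r FaFb∈
      wrap (no q+t≮r)  = resp′ (cong (_% N) (begin
          g ^ p * (g ^ r * (F a * F b)) ≡⟨ *-assoc (g ^ p) (g ^ r) (F a * F b) ⟨
          g ^ p * g ^ r * (F a * F b)   ≡⟨ cong (_* (F a * F b)) (^-distribˡ-+-* g p r) ⟨
          g ^ (p + r) * (F a * F b)     ≡⟨ cong (λ e → g ^ e * (F a * F b)) p+r≡ ⟩
          g ^ (q + t) * (F a * F b)     ∎))
        (coset⊆ p<r (mul g^r∈ FaFb∈))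
        where
        open ≡-Reasoning
        p : ℕ
        p = q + t ∸ r
        p+r≡ : p + r ≡ q + t
        p+r≡ = m∸n+n≡m (≮⇒≥ q+t≮r)
        p<r : p < r
        p<r = +-cancelʳ-< r p r (≤-<-trans (≤-reflexive p+r≡) (+-mono-< q<r t<r))

    mul′ : ∀ {u v} → Image steps′ (r * M) u → Image steps′ (r * M) v → Image steps′ (r * M) (u * v)
    mul′ (i , i< , Fi≈u) (j , j< , Fj≈v) = mul-mixed (toMixed i<) (toMixed j<) Fi≈u Fj≈v

    extended : Chain (suc k)
    extended = record
      { size = r * M ; steps = steps′ ; injective = injective′ ; member = member′ ; one = one′ ; mul = mul′
      ; bounded = ++⁺ (block-< g (≤-trans size≤N N≤2^ℓ) ≤-refl) bounded
      ; length≡ = trans (length-++ (block M g ℓ)) (cong₂ _+_ (length-block M g ℓ) length≡)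
      ; 2^k≤size = *-mono-≤ (s≤s 1≤m) 2^k≤size }

  extend : ∀ {k} (C : Chain k) {g} → Q g → ¬ Image (Chain.steps C) (Chain.size C) g → Chain (suc k)
  extend C {g} Qg g∉ =
    let open Chain C
        (e , e<N , g^e≈1) = order Qg
        (m , m≤e , g^r∈ , minimal) = least (λ m → image? (g ^ suc m)) e (image-resp (sym g^e≈1) one)
        -- `m = 0` would put g itself into the old subgroup.
        1≤m = n≢0⇒n>0 λ m≡0 → g∉ (image-resp (cong (_% N) (*-identityʳ g))
          (subst (λ m → Image steps size (g ^ suc m)) m≡0 g^r∈))
    in Extend.extended C Qg m 1≤m (≤-trans (≤-<-trans m≤e e<N) N≤2^ℓ) g^r∈ minimal


  Complete : ∀ {k} → Chain k → Set
  Complete C = ∀ {v} → Q v → Image (Chain.steps C) (Chain.size C) v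

  -- Fuel N suffices: otherwise k would reach N, while k < 2^k ≤ `size` ≤ N. Only representatives
  -- below N are searched, since `Q` and `Image` respect congruence.
  complete : ∃[ k ] Σ[ C ∈ Chain k ] Complete C
  complete = grow N trivial (m≤m+n N 0)
    where
    grow : ∀ fuel {k} → Chain k → N ≤ fuel + k → ∃[ k ] Σ[ C ∈ Chain k ] Complete C
    grow zero {k} C N≤k = contradiction (≤-trans (Chain.2^k≤size C) (≤-trans (Chain.size≤N C) N≤k)) (<⇒≱ (k<2^k k))
    grow (suc fuel) {k} C N≤ with anyUpTo? (λ x → Q? x ×-dec ¬? (Chain.image? C x)) N
    ... | yes (g , _ , Qg , g∉) = grow fuel (extend C Qg g∉) (≤-trans N≤ (≤-reflexive (sym (+-suc fuel k))))
    ... | no  all∈ = k , C , λ {v} Qv → decidable-stable (Chain.image? C v) λ v∉ →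
          all∈ (v % N , m%n<n v N , Q-resp (sym (m%n%n≡m%n v N)) Qv ,
            λ v∈ → v∉ (Chain.image-resp C (m%n%n≡m%n v N) v∈))

  length≤ : ∀ {k} (C : Chain k) → length (Chain.steps C) ≤ ℓ * ℓ
  length≤ {k} C = ≤-trans (≤-reflexive (Chain.length≡ C)) (*-monoˡ-≤ ℓ k≤ℓ)
    where
    open ≤-Reasoning
    k≤ℓ : k ≤ ℓ
    k≤ℓ = ≮⇒≥ λ ℓ<k → <⇒≱ (^-monoʳ-< 2 (s≤s (s≤s z≤n)) ℓ<k) (begin
      2 ^ k         ≤⟨ Chain.2^k≤size C ⟩
      Chain.size C  ≤⟨ Chain.size≤N C ⟩
      N             ≤⟨ N≤2^ℓ ⟩
      2 ^ ℓ         ∎)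

-- Quadratic residues

-- Indices start at 0 here. No chain is mentioned, so that N = 1 can be handled separately.
record Indexing (S : Pred ℕ 0ℓ) (N : ℕ) ⦃ _ : NonZero N ⦄ (ℓ : ℕ) : Set where
  field
    size       : ℕ
    steps      : List (ℕ × ℕ)
    size≤N     : size ≤ N
    length≤    : length steps ≤ ℓ * ℓ
    bounded    : All (λ s → proj₁ s < 2 ^ (ℓ + ℓ)) steps
    member     : ∀ {i} → i < size → S (evaluate steps i % N)
    injective  : ∀ {i j} → i < size → j < size → evaluate steps i % N ≡ evaluate steps j % N → i ≡ j
    surjective : ∀ {z} → S z → ∃[ i ] i < size × evaluate steps i % N ≡ z

QR? : ∀ N → Decidable (QR N)
QR? N z = unit? z ×-dec map′
  (λ (x , _ , ux , eq) → x , ux , eq)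
  (λ (x , ux@(_ , x<N , _) , eq) → x , x<N , ux , eq)
  (anyUpTo? (λ x → unit? x ×-dec N ∣? ∣ z - x * x ∣) N)
  where
  unit? : Decidable ℤ*[ N ]
  unit? x = 1 ≤? x ×-dec x <? N ×-dec gcd x N ≟ 1

module QuadraticResidues (N : ℕ) ⦃ _ : NonZero N ⦄ (1<N : 1 < N) where

  open Congruence N

  coprime-% : ∀ {a} → Coprime a N → Coprime (a % N) N
  coprime-% coprime (d∣a%N , d∣N) = coprime (∣n∣m%n⇒∣m d∣N d∣a%N , d∣N)

  coprime-* : ∀ {a b} → Coprime a N → Coprime b N → Coprime (a * b) N
  coprime-* ca cb {d} (d∣ab , d∣N) = cb (coprime-divisor coprime-d-a d∣ab , d∣N)
    where
    coprime-d-a : Coprime d _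
    coprime-d-a (e∣d , e∣a) = ca (e∣a , ∣-trans e∣d d∣N)

  coprime-resp : ∀ {a b} → a ≈ b → Coprime a N → Coprime b N
  coprime-resp {a} {b} a≈b ca (d∣b , d∣N) =
    coprime-% ca (subst (_ ∣_) (sym a≈b) (%-presˡ-∣ d∣b d∣N) , d∣N)

  unit : ∀ {a} → Coprime a N → ℤ*[ N ] (a % N)
  unit {a} coprime = n≢0⇒n>0 nonzero , m%n<n a N , coprime⇒gcd≡1 (coprime-% coprime)
    where
    nonzero : a % N ≢ 0
    nonzero eq = <⇒≢ 1<N (sym (coprime-% coprime (subst (N ∣_) (sym eq) (N ∣0) , ∣-refl)))

  -- The extension of `QR N` from reduced representatives to all naturals, as closure under
  -- unreduced products requires.
  Square : Pred ℕ 0ℓ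
  Square a = ∃[ x ] Coprime x N × a ≈ x * x

  square⇒QR : ∀ {a} → Square a → QR N (a % N)
  square⇒QR {a} (x , coprime , a≈x²) =
    unit (coprime-resp (sym a≈x²) (coprime-* coprime coprime)) , x % N , unit coprime ,
    ≈⇒∣ (a % N) (x % N * (x % N)) (trans (m%n%n≡m%n a N) (trans a≈x² (%-distribˡ-* x x N)))

  QR⇒square : ∀ {z} → QR N z → Square z
  QR⇒square (_ , x , (_ , _ , gcd≡1) , z≡x²) = x , gcd≡1⇒coprime gcd≡1 , ∣⇒≈ _ _ z≡x²

  square-resp : ∀ {a b} → a ≈ b → Square a → Square b
  square-resp a≈b (x , coprime , eq) = x , coprime , trans (sym a≈b) eq

  square? : Decidable Square
  square? a = map′ (λ qr → square-resp (m%n%n≡m%n a N) (QR⇒square qr)) square⇒QR (QR? N (a % N))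

  square-1 : Square 1
  square-1 = 1 , Coprime.1-coprimeTo N , refl

  square-* : ∀ {a b} → Square a → Square b → Square (a * b)
  square-* (x , cx , a≈) (y , cy , b≈) = x * y , coprime-* cx cy ,
    trans (*-cong-≈ a≈ b≈) (cong (_% N) (solve 2 (λ x y → x :* x :* (y :* y) := x :* y :* (x :* y)) refl x y))
    where open +-*-Solver

  -- As y is coprime to N, so is x ≈ y²; hence N, which divides x * ∣ a - b ∣, divides ∣ a - b ∣.
  square-cancel : ∀ {x a b} → Square x → x * a ≈ x * b → a ≈ b
  square-cancel {x} {a} {b} (y , cy , x≈y²) eq = ∣⇒≈ a b
    (coprime-divisor (Coprime.sym (coprime-resp (sym x≈y²) (coprime-* cy cy)))
      (subst (N ∣_) (sym (*-distribˡ-∣-∣ x a b)) (≈⇒∣ (x * a) (x * b) eq)))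

  indexing : ∀ {ℓ} → N ≤ 2 ^ ℓ → Indexing (QR N) N ℓ
  indexing {ℓ} N≤2^ℓ = record
    { size = size ; steps = steps ; size≤N = size≤N ; length≤ = length≤ C ; bounded = bounded
    ; member = λ i< → square⇒QR (member i<) ; injective = injective
    ; surjective = λ {z} qr@((_ , z<N , _) , _) →
        let (i , i< , eq) = total (QR⇒square qr) in i , i< , trans eq (m<n⇒m%n≡m z<N)
    }
    where
    open Chains N Square square? square-resp square-1 square-* square-cancel ℓ N≤2^ℓ
    C = proj₁ (proj₂ complete)
    total = proj₂ (proj₂ complete)
    open Chain C

-- For N = 1 no x satisfies 1 ≤ x < 1, so the set is empty and `size` is 0. The general argument
-- uses 1 < N to know that residues of coprime numbers are nonzero.
QR-indexing : ∀ n {ℓ} → suc n ≤ 2 ^ ℓ → Indexing (QR (suc n)) (suc n) ℓ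
QR-indexing zero    _     = record
  { size = 0 ; steps = [] ; size≤N = z≤n ; length≤ = z≤n ; bounded = [] ; member = λ ()
  ; injective = λ () ; surjective = λ { ((s≤s _ , s≤s () , _) , _) } }
QR-indexing (suc n) N≤2^ℓ = QuadraticResidues.indexing (suc (suc n)) (s≤s (s≤s z≤n)) N≤2^ℓ

-- Polynomial bounds

-- Closed under sums and products, so the polynomial for the size bound is assembled by mirroring
-- its expression, without expanding coefficients.
IsPolynomial : (ℕ → ℕ) → Set
IsPolynomial f = Σ[ q ∈ Polynomial ] ∀ x → evalPoly q x ≡ f x

addP : Polynomial → Polynomial → Polynomial
addP []      q       = q
addP (a ∷ p) []      = a ∷ p
addP (a ∷ p) (b ∷ q) = a + b ∷ addP p q

eval-addP : ∀ p q x → evalPoly (addP p q) x ≡ evalPoly p x + evalPoly q x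
eval-addP []      q       x = refl
eval-addP (a ∷ p) []      x = sym (+-identityʳ _)
eval-addP (a ∷ p) (b ∷ q) x = trans (cong (λ e → a + b + x * e) (eval-addP p q x))
  (solve 5 (λ a b x p q → a :+ b :+ x :* (p :+ q) := a :+ x :* p :+ (b :+ x :* q)) refl a b x (evalPoly p x) (evalPoly q x))
  where open +-*-Solver

scaleP : ℕ → Polynomial → Polynomial
scaleP c = List.map (c *_)

eval-scaleP : ∀ c p x → evalPoly (scaleP c p) x ≡ c * evalPoly p x
eval-scaleP c []      x = sym (*-zeroʳ c)
eval-scaleP c (a ∷ p) x = trans (cong (λ e → c * a + x * e) (eval-scaleP c p x))
  (solve 4 (λ c a x p → c :* a :+ x :* (c :* p) := c :* (a :+ x :* p)) refl c a x (evalPoly p x))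
  where open +-*-Solver

mulP : Polynomial → Polynomial → Polynomial
mulP []      q = []
mulP (a ∷ p) q = addP (scaleP a q) (0 ∷ mulP p q)

eval-mulP : ∀ p q x → evalPoly (mulP p q) x ≡ evalPoly p x * evalPoly q x
eval-mulP []      q x = refl
eval-mulP (a ∷ p) q x = begin
  evalPoly (addP (scaleP a q) (0 ∷ mulP p q)) x       ≡⟨ eval-addP (scaleP a q) (0 ∷ mulP p q) x ⟩
  evalPoly (scaleP a q) x + x * evalPoly (mulP p q) x ≡⟨ cong₂ (λ y z → y + x * z) (eval-scaleP a q x) (eval-mulP p q x) ⟩
  a * Q + x * (P * Q)                                 ≡⟨ solve 4 (λ a x P Q → a :* Q :+ x :* (P :* Q) := (a :+ x :* P) :* Q) refl a x P Q ⟩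
  (a + x * P) * Q                                     ∎
  where
  open ≡-Reasoning
  open +-*-Solver
  P Q : ℕ
  P = evalPoly p x
  Q = evalPoly q x

const-polynomial : ∀ c → IsPolynomial (λ _ → c)
const-polynomial c = c ∷ [] , λ x → trans (cong (c +_) (*-zeroʳ x)) (+-identityʳ c)

id-polynomial : IsPolynomial (λ x → x)
id-polynomial = 0 ∷ 1 ∷ [] , λ x → trans (cong (λ y → x * (1 + y)) (*-zeroʳ x)) (*-identityʳ x)

infixl 6 _+ᵖ_
infixl 7 _*ᵖ_

_+ᵖ_ : ∀ {f g} → IsPolynomial f → IsPolynomial g → IsPolynomial (λ x → f x + g x)
(p , p≡) +ᵖ (q , q≡) = addP p q , λ x → trans (eval-addP p q x) (cong₂ _+_ (p≡ x) (q≡ x))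

_*ᵖ_ : ∀ {f g} → IsPolynomial f → IsPolynomial g → IsPolynomial (λ x → f x * g x)
(p , p≡) *ᵖ (q , q≡) = mulP p q , λ x → trans (eval-mulP p q x) (cong₂ _*_ (p≡ x) (q≡ x))

fromDigits-< : ∀ (ds : Expansion 2) → fromDigits ds < 2 ^ length ds
fromDigits-< []       = ≤-refl
fromDigits-< (d ∷ ds) = begin-strict
  toℕ d + fromDigits ds * 2   <⟨ +-monoˡ-< (fromDigits ds * 2) (toℕ<n d) ⟩
  suc (fromDigits ds) * 2     ≤⟨ *-monoˡ-≤ 2 (fromDigits-< ds) ⟩
  2 ^ length ds * 2           ≡⟨ *-comm (2 ^ length ds) 2 ⟩
  2 ^ suc (length ds)         ∎
  where open ≤-Reasoning

length-⟨⟩ : ∀ n → length ⟨ n ⟩ ≡ length (proj₁ (toDigits 2 n))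
length-⟨⟩ n = length-map _ (proj₁ (toDigits 2 n))

n<2^length : ∀ n → n < 2 ^ length ⟨ n ⟩
n<2^length n = subst₂ (λ m l → m < 2 ^ l) (proj₂ (toDigits 2 n)) (sym (length-⟨⟩ n))
  (fromDigits-< (proj₁ (toDigits 2 n)))

-- Compares the input width, the length of ⟨ `size` ⟩, with the length of ⟨ N ⟩. From m ≤ n <
-- 2^length ⟨ n ⟩, the bound on the digits of m is `toDigits-short`.
length-⟨⟩-mono : ∀ {m n} → 1 ≤ n → m ≤ n → length ⟨ m ⟩ ≤ length ⟨ n ⟩
length-⟨⟩-mono {m} {n} 1≤n m≤n with length ⟨ n ⟩ | n<2^length n
... | zero  | n<1 = contradiction 1≤n (<⇒≱ n<1)
... | suc L | n<  = ≤-trans (≤-reflexive (length-⟨⟩ m)) (Short.length≤ (toDigits-short m) L (≤-<-trans m≤n n<))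

pred-< : ∀ {i M} → 1 ≤ i → i ≤ M → pred i < M
pred-< {suc i} _ i<M = i<M

pred-injective⁺ : ∀ {i j} → 1 ≤ i → 1 ≤ j → pred i ≡ pred j → i ≡ j
pred-injective⁺ {suc i} {suc j} _ _ = cong suc

stepBound : ℕ → ℕ → ℕ
stepBound A W = 1 + A * 32 + A * 4 + (W + W * (1 + W * 32 + (1 + W * 32 + W * 4) + W * 4) + W * 4)

-- In order: inputs, padding, initial accumulator, at most ℓ² + 1 steps, outputs. The counter has at
-- most 3ℓ bits and residues have ℓ + 1; `stepBound` is `step-cost` with the word sizes evaluated.
circuitBound : ℕ → ℕ
circuitBound ℓ = ℓ + (ℓ + ℓ + suc ℓ + suc (ℓ * ℓ) * stepBound (ℓ + (ℓ + ℓ)) (suc ℓ) + 0) + suc ℓ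

circuitBound-polynomial : IsPolynomial circuitBound
circuitBound-polynomial =
  x +ᵖ (x +ᵖ x +ᵖ W +ᵖ (c 1 +ᵖ x *ᵖ x) *ᵖ
    (c 1 +ᵖ A *ᵖ c 32 +ᵖ A *ᵖ c 4 +ᵖ
      (W +ᵖ W *ᵖ (c 1 +ᵖ W *ᵖ c 32 +ᵖ (c 1 +ᵖ W *ᵖ c 32 +ᵖ W *ᵖ c 4) +ᵖ W *ᵖ c 4) +ᵖ W *ᵖ c 4)) +ᵖ c 0) +ᵖ W
  where
  x : IsPolynomial (λ ℓ → ℓ)
  x = id-polynomial
  c : ∀ k → IsPolynomial (λ _ → k)
  c = const-polynomial
  A : IsPolynomial (λ ℓ → ℓ + (ℓ + ℓ))
  A = x +ᵖ (x +ᵖ x)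
  W : IsPolynomial (λ ℓ → suc ℓ)
  W = c 1 +ᵖ x

-- The encoding and its decoding circuit

module _ {S N ℓ} ⦃ _ : NonZero N ⦄ (I : Indexing S N ℓ) where
  open Indexing I

  encoding : Encoding S
  encoding = record { size = size ; decode = record
    { to = λ (i , 1≤i , i≤size) → evaluate steps (pred i) % N , member (pred-< 1≤i i≤size)
    ; cong = cong (λ i → evaluate steps (pred i) % N)
    ; surjective = λ (z , z∈S) → let (i , i< , eq) = surjective z∈S in
        (suc i , s≤s z≤n , i<) , λ { refl → eq } } }

  encoding-isIndexing : IsIndexing encoding
  encoding-isIndexing = record
    { to = Surjection.to decode ; cong = λ {x} {y} → Surjection.cong decode {x} {y}
    ; bijective = (λ { {_ , 1≤i , i≤} {_ , 1≤j , j≤} eq →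
          pred-injective⁺ 1≤i 1≤j (injective (pred-< 1≤i i≤) (pred-< 1≤j j≤) eq) })
        , Surjection.surjective decode }
    where
    open Encoding encoding using (decode)

  module _ (N<2^ℓ : N < 2 ^ ℓ) (input≤ℓ : length ⟨ size ⟩ ≤ ℓ) where

    input width counter : ℕ
    input   = length ⟨ size ⟩
    -- One bit beyond ℓ, so that N < 2^ℓ gives 2N ≤ 2^width.
    width   = suc ℓ
    -- Wide enough for both the index and the thresholds, which lie below 2^(2ℓ).
    counter = input + (ℓ + ℓ)

    open Modular N width (*-monoʳ-≤ 2 (<⇒≤ N<2^ℓ))

    -- Indices start at 1: the first step subtracts 1 and multiplies by 1.
    program : List (ℕ × ℕ)
    program = (1 , 1) ∷ steps

    program-bounded : All (λ s → proj₁ s < 2 ^ counter) program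
    program-bounded = All.map (λ T< → <-≤-trans T< (^-monoʳ-≤ 2 (m≤n+m (ℓ + ℓ) input)))
      (≤-<-trans (>-nonZero⁻¹ N) (<-≤-trans N<2^ℓ (^-monoʳ-≤ 2 (m≤m+n ℓ ℓ))) ∷ bounded)

    decoder : Val (Word input) → Val (Word width)
    -- `1 % N` instead of 1 keeps the accumulator below N even for N = 1.
    decoder x = proj₂ (run counter program (pad input (ℓ + ℓ) x , word width (1 % N)))

    #-decoder : ∀ {i} → 1 ≤ i → i ≤ size →
      # width (decoder (word input i)) ≡ evaluate steps (pred i) % N
    #-decoder {suc i} 1≤i i≤size = begin
      # width (decoder (word input (suc i)))
        ≡⟨ #-run counter program-bounded _ _ (≤-<-trans (≤-reflexive #one) (m%n<n 1 N)) ⟩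
      (# width (word width (1 % N)) * evaluate program (# counter (pad input (ℓ + ℓ) (word input (suc i))))) % N
        ≡⟨ cong₂ (λ a k → (a * evaluate program k) % N) #one #index ⟩
      (1 % N * evaluate program (suc i)) % N
        ≡⟨ Congruence.*-cong-≈ N {1 % N} {1} {evaluate program (suc i)} (m%n%n≡m%n 1 N) refl ⟩
      (1 * evaluate program (suc i)) % N
        ≡⟨ cong (_% N) (trans (*-identityˡ _) (*-identityˡ _)) ⟩
      evaluate steps i % N ∎
      where
      open ≡-Reasoning
      #one : # width (word width (1 % N)) ≡ 1 % N
      #one = #-word width (<-trans (m%n<n 1 N) N<2^W)
      #index : # counter (pad input (ℓ + ℓ) (word input (suc i))) ≡ suc i
      #index = trans (#-pad input (ℓ + ℓ) _) (#-word input (≤-<-trans i≤size (n<2^length size)))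

    decoder-cost : ℕ
    decoder-cost = bits (Word (ℓ + ℓ)) + bits (Word width) + length program * step-cost counter + 0

    decoder-realised : Realised (Word input) (Word width) decoder decoder-cost
    decoder-realised =
      fork (pad-realised input (ℓ + ℓ)) (constant (Word width) (word width (1 % N)))
      ▹ run-realised counter program ▹ snd

    size-bound : input + decoder-cost + width ≤ circuitBound ℓ
    size-bound rewrite bits-Word (ℓ + ℓ) | bits-Word ℓ | bits-Word counter =
      +-monoˡ-≤ (suc ℓ) (+-mono-≤ input≤ℓ (+-monoˡ-≤ 0 (+-monoʳ-≤ (ℓ + ℓ + suc ℓ)
        (*-mono-≤ (s≤s length≤) (+-monoˡ-≤ _ (+-mono-≤ (s≤s (*-monoˡ-≤ 32 counter≤)) (*-monoˡ-≤ 4 counter≤)))))))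
      where
      counter≤ : counter ≤ ℓ + (ℓ + ℓ)
      counter≤ = +-monoˡ-≤ (ℓ + ℓ) input≤ℓ

    circuit-computes : ∃[ m ] Σ[ C ∈ Circuit input m ] circuitSize C ≤ circuitBound ℓ × Computes encoding C
    circuit-computes =
      let (C , C≤ , correct) = compile decoder-realised
      in width , C , ≤-trans C≤ size-bound ,
         λ (i , 1≤i , i≤) → trans (correct (toBits input i)) (#-decoder 1≤i i≤)

theorem1 : Σ[ D ∈ Ensemble (λ n → QR (suc n)) ]
    (∀ n → IsIndexing (D n)) × PolySizeDecodable ⟨suc⟩ D
theorem1 = (λ n → encoding (indexing n)) , (λ n → encoding-isIndexing (indexing n)) ,
  proj₁ circuitBound-polynomial , λ n →
    let (m , C , C≤ , computes) = circuit-computes (indexing n) (n<2^length (suc n))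
          (length-⟨⟩-mono (s≤s z≤n) (Indexing.size≤N (indexing n)))
    in m , C , ≤-trans C≤ (≤-reflexive (sym (proj₂ circuitBound-polynomial (length ⟨ suc n ⟩)))) , computes
  where
  -- With ℓ the length of ⟨ N ⟩, `circuitBound` is evaluated at exactly the length of the name.
  indexing : ∀ n → Indexing (QR (suc n)) (suc n) (length ⟨ suc n ⟩)
  indexing n = QR-indexing n (<⇒≤ (n<2^length (suc n)))
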